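{- Let $a$ and $b$ be positive odd integers with $\gcd(a,b)=1$, and for $p\in\mathbb{N}_0$ let $$T_p(a,b)=2\sum_{j=0}^{b-1}(-1)^j\,\overline{E}_p\!\left(\frac{aj}{b}\right)\overline{E}_1\!\left(\frac{j}{b}\right).$$ (1) If $p$ is an even positive integer, then $$ab^{p+1}T_p(a,b)+a^{p+1}b\,T_p(b,a)=2E_{p+1}(0)-ab\sum_{k=0}^{p-1}\binom{p}{k}b^{k}E_{k}(0)\,a^{p-k}E_{p-k}(0).$$ (2) If $p$ is an odd positive integer, then $$b^{p}T_p(a,b)-a^{p}T_p(b,a)=(a^p-b^p)E_p(0).$$
   Context: The Euler polynomials $E_k(x)$, $k\in\mathbb{N}_0$, are defined by $\frac{2e^{xt}}{e^t+1}=\sum_{k=0}^\infty E_k(x)\frac{t^k}{k!}$. The quasi-periodic Euler function is $\overline{E}_k(x)=(-1)^{[x]}E_k(\{x\})$ for real $x$, where $[x]$ is the greatest integer not exceeding $x$ and $\{x\}=x-[x]$; equivalently $\overline{E}_k(x)=E_k(x)$ for $0\le x<1$ and $\overline{E}_k(x+1)=-\overline{E}_k(x)$. -}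

module Defs where

open import Data.Nat as ℕ using (ℕ; zero; suc; NonZero)
open import Data.Nat.DivMod using (_%_)
open import Data.Nat.Combinatorics using (_C_)
open import Data.Integer as ℤ using (ℤ; +_; ∣_∣)
open import Data.Rational using (ℚ; _+_; _*_; _-_; -_; _/_; ½; 0ℚ; 1ℚ; floor)
open import Data.List using (List; []; _∷_; _++_; [_]; upTo; zipWith; foldr)

ℕ→ℚ : ℕ → ℚ
ℕ→ℚ n = (+ n) / 1

ℤ→ℚ : ℤ → ℚ
ℤ→ℚ z = z / 1

_^ℚ_ : ℚ → ℕ → ℚ
x ^ℚ zero = 1ℚ
x ^ℚ suc n = x * (x ^ℚ n)

sumℚ : List ℚ → ℚ
sumℚ = foldr _+_ 0ℚ

Σ< : ℕ → (ℕ → ℚ) → ℚ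
Σ< zero f = 0ℚ
Σ< (suc n) f = Σ< n f + f n

-- Euler polynomials.  Comparing coefficients of t^n in
--   2 e^{xt} = (e^t + 1) Σ_k E_k(x) t^k / k!
-- gives  2 x^n = Σ_{k=0}^{n} C(n,k) E_k(x) + E_n(x), i.e.
--   E_n(x) = x^n - ½ Σ_{k=0}^{n-1} C(n,k) E_k(x).
-- 'eulerStep n x l' computes E_n(x) from l = [E_0(x), ..., E_{n-1}(x)].
eulerStep : ℕ → ℚ → List ℚ → ℚ
eulerStep n x l = (x ^ℚ n) - ½ * sumℚ (zipWith (λ k e → ℕ→ℚ (n C k) * e) (upTo n) l)

eulerList : ℕ → ℚ → List ℚ
eulerList zero x = []
eulerList (suc n) x = eulerList n x ++ [ eulerStep n x (eulerList n x) ]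

E : ℕ → ℚ → ℚ
E n x = eulerStep n x (eulerList n x)

signℤ : ℤ → ℚ
signℤ m with ∣ m ∣ % 2
... | zero = 1ℚ
... | suc _ = - 1ℚ

Ebar : ℕ → ℚ → ℚ
Ebar k x = signℤ (floor x) * E k (x - ℤ→ℚ (floor x))

T : ℕ → (a b : ℕ) → .{{NonZero b}} → ℚ
T p a b = ℕ→ℚ 2 * Σ< b (λ j → signℤ (+ j) * Ebar p ((+ (a ℕ.* j)) / b) * Ebar 1 ((+ j) / b))

{-# OPTIONS --safe #-}

-- Work with exponential generating functions.  Put w = -eᵗ and Uₙ = 2 / (eⁿᵗ + 1), so that for
-- odd n Uₙ (1 - wⁿ) = 2 and the coefficients of U₁ are E_k(0).  As a and b are odd,
-- b^{p+1} T_p(a, b) is the p-th coefficient of  Σ_{j<b} (2j - b) U_b w^{aj mod b}.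
-- For odd p the terms j and b - j cancel, leaving T_p(a, b) = -E_p(0).
-- In general
--   U_b w^{aj mod b} = U_b w^{aj} + 2 Σ_{0 < m, mb ≤ aj} w^{aj - mb}.
-- Let g be the sum of w^{aj - mb} over the lattice points 0 < j < b, 0 < m < a with mb ≤ aj.
-- Since j ↦ aj mod b is a permutation, summing over j gives U₁ = U_b Σ_j w^{aj} + 2 g.
-- In a · (sum for (a, b)) + b · (sum for (b, a)) the reflection (j, m) ↦ (b - j, a - m) makes
-- the weights of the lattice points combine to 2 (aj - mb), that is, to 2 dg/dt.
-- Substituting for g, everything collapses to 2 dU₁/dt - ab U_a U_b.
module Submission where

open import Defs
open import Data.Nat using (ℕ; zero; suc; NonZero; _∸_)
open import Data.Nat.DivMod using (_%_)
open import Data.Nat.GCD using (gcd)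
open import Data.Nat.Combinatorics using (_C_)
open import Data.Rational using (ℚ; _+_; _*_; _-_)
open import Data.Product using (_×_)
open import Relation.Binary.PropositionalEquality using (_≡_)

open import Algebra.Bundles using (CommutativeRing)
import Algebra.Properties.CommutativeMonoid.Sum
import Algebra.Solver.Ring
open import Algebra.Solver.Ring.AlmostCommutativeRing
  using (fromCommutativeRing; _-Raw-AlmostCommutative⟶_)
open import Data.Fin using (Fin; toℕ; fromℕ<)
open import Data.Fin.Permutation using (permutation)
import Data.Fin.Properties as Finₚ
open import Data.Integer as ℤ using (ℤ)
import Data.Integer.Properties as ℤₚ
open import Data.List using ([]; _∷_; _++_; upTo; applyUpTo; zipWith)
open import Data.List.Properties using (applyUpTo-∷ʳ)
open import Data.Maybe using (Maybe; just; nothing)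
open import Data.Nat as ℕ using (_<_; _≤_; z≤n; s≤s)
open import Data.Nat.Combinatorics
  using (nCk+nC[k+1]≡[n+1]C[k+1]; k>n⇒nCk≡0; nCn≡1; nCk≡nC[n∸k])
open import Data.Nat.Coprimality as Coprimality using (Coprime)
open import Data.Nat.Divisibility using (divides; m%n≡0⇒n∣m; ∣⇒≤)
import Data.Nat.DivMod as ℕ/
open import Data.Nat.GCD using (gcd[m,n]∣n; gcd[m,n]≢0; n/gcd[m,n]≢0; module Bézout)
import Data.Nat.Properties as ℕₚ
import Data.Nat.Solver as ℕSolver
open import Data.Product using (Σ; _,_)
open import Data.Rational using (mkℚ; mkℚ+; -_; _/_; ½; 0ℚ; 1ℚ; floor)
import Data.Rational.Properties as ℚₚ
import Data.Rational.Solver as ℚSolver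
import Data.Rational.Unnormalised as ℚᵘ
import Data.Rational.Unnormalised.Properties as ℚᵘₚ
open import Data.Sum using (inj₂)
open import Function using (_∘_)
open import Relation.Binary.PropositionalEquality
  using (refl; sym; trans; cong; cong₂; subst; module ≡-Reasoning)
open import Relation.Nullary using (contradiction; ¬_; yes; no)

open Algebra.Properties.CommutativeMonoid.Sum ℚₚ.+-0-commutativeMonoid
  using (sum; sum-permute; sum-cong-≗)
open ℚSolver.+-*-Solver using (_:+_; _:*_; _:=_; :-_; con; solve; _:-_)
open ℕSolver.+-*-Solver using ()
  renaming (_:+_ to _⊹_; _:*_ to _∗_; _:=_ to _≔_; con to lit; solve to solve-ℕ)

-- The ring of exponential generating functions

Series : Set
Series = ℕ → ℚ

infix 4 _≈_
record _≈_ (f g : Series) : Set where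
  constructor pointwise
  field
    at : ∀ n → f n ≡ g n
open _≈_

≈-refl : ∀ {f} → f ≈ f
≈-refl .at n = refl

≈-sym : ∀ {f g} → f ≈ g → g ≈ f
≈-sym p .at n = sym (at p n)

≈-trans : ∀ {f g h} → f ≈ g → g ≈ h → f ≈ h
≈-trans p q .at n = trans (at p n) (at q n)

≈-reflexive : ∀ {f g} → f ≡ g → f ≈ g
≈-reflexive refl = ≈-refl

infixl 6 _⊕_
infixl 7 _⊛_ _·_
infix 8 ⊖_

_⊕_ : Series → Series → Series
(f ⊕ g) n = f n + g n

⊖_ : Series → Series
(⊖ f) n = - f n

_·_ : ℚ → Series → Series
(c · f) n = c * f n

δ : Series → Series
δ f n = f (suc n)

-- A sequence f stands for the exponential generating function Σ f n tⁿ / n!,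
-- so δ is d/dt and the product is determined by the Leibniz rule.
_⊛_ : Series → Series → Series
(f ⊛ g) zero = f 0 * g 0
(f ⊛ g) (suc n) = (δ f ⊛ g) n + (f ⊛ δ g) n

κ : ℚ → Series
κ c zero = c
κ c (suc n) = 0ℚ

⊕-cong : ∀ {f f′ g g′} → f ≈ f′ → g ≈ g′ → f ⊕ g ≈ f′ ⊕ g′
⊕-cong p q .at n = cong₂ _+_ (at p n) (at q n)

δ-cong : ∀ {f g} → f ≈ g → δ f ≈ δ g
δ-cong p .at n = at p (suc n)

⊛-cong : ∀ {f f′ g g′} → f ≈ f′ → g ≈ g′ → f ⊛ g ≈ f′ ⊛ g′
⊛-cong {f} {f′} {g} {g′} p q .at zero = cong₂ _*_ (at p 0) (at q 0)
⊛-cong {f} {f′} {g} {g′} p q .at (suc n) =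
  cong₂ _+_ (at (⊛-cong (δ-cong p) q) n) (at (⊛-cong p (δ-cong q)) n)

⊛-comm : ∀ f g → f ⊛ g ≈ g ⊛ f
⊛-comm f g .at zero = ℚₚ.*-comm (f 0) (g 0)
⊛-comm f g .at (suc n) = trans
  (cong₂ _+_ (at (⊛-comm (δ f) g) n) (at (⊛-comm f (δ g)) n))
  (ℚₚ.+-comm ((g ⊛ δ f) n) ((δ g ⊛ f) n))

⊛-distribʳ-⊕ : ∀ h f g → (f ⊕ g) ⊛ h ≈ f ⊛ h ⊕ g ⊛ h
⊛-distribʳ-⊕ h f g .at zero = ℚₚ.*-distribʳ-+ (h 0) (f 0) (g 0)
⊛-distribʳ-⊕ h f g .at (suc n) = trans
  (cong₂ _+_ (at (⊛-distribʳ-⊕ h (δ f) (δ g)) n) (at (⊛-distribʳ-⊕ (δ h) f g) n))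
  (solve 4 (λ a b c d → (a :+ b) :+ (c :+ d) := (a :+ c) :+ (b :+ d)) refl
    ((δ f ⊛ h) n) ((δ g ⊛ h) n) ((f ⊛ δ h) n) ((g ⊛ δ h) n))

⊛-distribˡ-⊕ : ∀ h f g → h ⊛ (f ⊕ g) ≈ h ⊛ f ⊕ h ⊛ g
⊛-distribˡ-⊕ h f g = ≈-trans (⊛-comm h (f ⊕ g))
  (≈-trans (⊛-distribʳ-⊕ h f g) (⊕-cong (⊛-comm f h) (⊛-comm g h)))

⊛-assoc : ∀ f g h → (f ⊛ g) ⊛ h ≈ f ⊛ (g ⊛ h)
⊛-assoc f g h .at zero = ℚₚ.*-assoc (f 0) (g 0) (h 0)
⊛-assoc f g h .at (suc n) = begin
  ((δ f ⊛ g ⊕ f ⊛ δ g) ⊛ h) n + (f ⊛ g ⊛ δ h) n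
    ≡⟨ cong (_+ (f ⊛ g ⊛ δ h) n) (at (⊛-distribʳ-⊕ h (δ f ⊛ g) (f ⊛ δ g)) n) ⟩
  (δ f ⊛ g ⊛ h) n + (f ⊛ δ g ⊛ h) n + (f ⊛ g ⊛ δ h) n
    ≡⟨ cong₂ _+_ (cong₂ _+_ (at (⊛-assoc (δ f) g h) n) (at (⊛-assoc f (δ g) h) n))
                 (at (⊛-assoc f g (δ h)) n) ⟩
  (δ f ⊛ (g ⊛ h)) n + (f ⊛ (δ g ⊛ h)) n + (f ⊛ (g ⊛ δ h)) n
    ≡⟨ ℚₚ.+-assoc ((δ f ⊛ (g ⊛ h)) n) ((f ⊛ (δ g ⊛ h)) n) ((f ⊛ (g ⊛ δ h)) n) ⟩
  (δ f ⊛ (g ⊛ h)) n + ((f ⊛ (δ g ⊛ h)) n + (f ⊛ (g ⊛ δ h)) n)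
    ≡⟨ cong ((δ f ⊛ (g ⊛ h)) n +_) (at (⊛-distribˡ-⊕ f (δ g ⊛ h) (g ⊛ δ h)) n) ⟨
  (δ f ⊛ (g ⊛ h)) n + (f ⊛ (δ g ⊛ h ⊕ g ⊛ δ h)) n ∎
  where open ≡-Reasoning

·-⊛ : ∀ c f g → (c · f) ⊛ g ≈ c · (f ⊛ g)
·-⊛ c f g .at zero = ℚₚ.*-assoc c (f 0) (g 0)
·-⊛ c f g .at (suc n) = trans
  (cong₂ _+_ (at (·-⊛ c (δ f) g) n) (at (·-⊛ c f (δ g)) n))
  (sym (ℚₚ.*-distribˡ-+ c ((δ f ⊛ g) n) ((f ⊛ δ g) n)))

·-cong : ∀ c {f g} → f ≈ g → c · f ≈ c · g
·-cong c p .at n = cong (c *_) (at p n)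

·-⊛ʳ : ∀ c f g → f ⊛ (c · g) ≈ c · (f ⊛ g)
·-⊛ʳ c f g = ≈-trans (⊛-comm f (c · g)) (≈-trans (·-⊛ c g f) (·-cong c (⊛-comm g f)))

·-⊕ : ∀ c f g → c · (f ⊕ g) ≈ c · f ⊕ c · g
·-⊕ c f g .at p = ℚₚ.*-distribˡ-+ c (f p) (g p)

κ0≡0 : ∀ n → κ 0ℚ n ≡ 0ℚ
κ0≡0 zero = refl
κ0≡0 (suc n) = refl

δκ-⊛ : ∀ f → δ (κ 0ℚ) ⊛ f ≈ κ 0ℚ
δκ-⊛ f .at zero = ℚₚ.*-zeroˡ (f 0)
δκ-⊛ f .at (suc n) = trans
  (cong₂ _+_ (at (⊛-cong {g = f} (pointwise (λ _ → refl)) ≈-refl) n) refl)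
  (cong₂ _+_ (trans (at (δκ-⊛ f) n) (κ0≡0 n)) (trans (at (δκ-⊛ (δ f)) n) (κ0≡0 n)))

κ-⊛ : ∀ c f → κ c ⊛ f ≈ c · f
κ-⊛ c f .at zero = refl
κ-⊛ c f .at (suc n) = trans
  (cong₂ _+_ (trans (at (δκ-⊛ f) n) (κ0≡0 n)) (at (κ-⊛ c (δ f)) n))
  (ℚₚ.+-identityˡ (c * f (suc n)))

κ-δ : ∀ c f → δ (κ c ⊛ f) ≈ κ c ⊛ δ f
κ-δ c f = ≈-trans (δ-cong (κ-⊛ c f)) (≈-sym (κ-⊛ c (δ f)))

⊛-identityˡ : ∀ f → κ 1ℚ ⊛ f ≈ f
⊛-identityˡ f = ≈-trans (κ-⊛ 1ℚ f) (pointwise (λ n → ℚₚ.*-identityˡ (f n)))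

seriesRing : CommutativeRing _ _
seriesRing = record
  { Carrier = Series ; _≈_ = _≈_ ; _+_ = _⊕_ ; _*_ = _⊛_ ; -_ = ⊖_ ; 0# = κ 0ℚ ; 1# = κ 1ℚ
  ; isCommutativeRing = record
    { isRing = record
      { +-isAbelianGroup = record
        { isGroup = record
          { isMonoid = record
            { isSemigroup = record
              { isMagma = record
                { isEquivalence = record { refl = ≈-refl ; sym = ≈-sym ; trans = ≈-trans }
                ; ∙-cong = ⊕-cong
                }
              ; assoc = λ f g h → pointwise (λ n → ℚₚ.+-assoc (f n) (g n) (h n))
              }
            ; identity =
                (λ f → pointwise (λ n → trans (cong (_+ f n) (κ0≡0 n)) (ℚₚ.+-identityˡ (f n))))
              , (λ f → pointwise (λ n → trans (cong (f n +_) (κ0≡0 n)) (ℚₚ.+-identityʳ (f n))))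
            }
          ; inverse =
              (λ f → pointwise (λ n → trans (ℚₚ.+-inverseˡ (f n)) (sym (κ0≡0 n))))
            , (λ f → pointwise (λ n → trans (ℚₚ.+-inverseʳ (f n)) (sym (κ0≡0 n))))
          ; ⁻¹-cong = λ p → pointwise (λ n → cong -_ (at p n))
          }
        ; comm = λ f g → pointwise (λ n → ℚₚ.+-comm (f n) (g n))
        }
      ; *-cong = ⊛-cong
      ; *-assoc = ⊛-assoc
      ; *-identity = ⊛-identityˡ , (λ f → ≈-trans (⊛-comm f (κ 1ℚ)) (⊛-identityˡ f))
      ; distrib = ⊛-distribˡ-⊕ , ⊛-distribʳ-⊕
      }
    ; *-comm = ⊛-comm
    }
  }

-- Rational coefficients let the ring solver cancel `κ ½` against `κ 2ℚ`, as the closed forms of the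
-- geometric sums require.
κ-morphism : CommutativeRing.rawRing ℚₚ.+-*-commutativeRing
             -Raw-AlmostCommutative⟶ fromCommutativeRing seriesRing
κ-morphism = record
  { ⟦_⟧ = κ
  ; +-homo = λ x y → pointwise λ where zero → refl
                                       (suc n) → refl
  ; *-homo = λ x y → ≈-trans
      (pointwise λ where zero → refl
                         (suc n) → sym (ℚₚ.*-zeroʳ x))
      (≈-sym (κ-⊛ x (κ y)))
  ; -‿homo = λ x → pointwise λ where zero → refl
                                     (suc n) → refl
  ; 0-homo = ≈-refl
  ; 1-homo = ≈-refl
  }

κ-≟ : ∀ x y → Maybe (κ x ≈ κ y)
κ-≟ x y with x ℚₚ.≟ y
... | yes p = just (pointwise (λ n → cong (λ z → κ z n) p))
... | no _ = nothing

module SeriesSolver = Algebra.Solver.Ring (CommutativeRing.rawRing ℚₚ.+-*-commutativeRing)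
  (fromCommutativeRing seriesRing) κ-morphism κ-≟
open SeriesSolver using ()
  renaming (_:+_ to _⊞_; _:*_ to _⊠_; :-_ to ⊟_; _:=_ to _≋_; con to K; solve to solveR)

-- Powers and finite sums

-- The quotient `_/_` divides by a gcd, which is stuck for a variable `n`; on this reduced form sums
-- and products compute.
ℕ→ℚ-mkℚ : ∀ n → ℕ→ℚ n ≡ mkℚ (ℤ.+ n) 0 (Coprimality.sym (Coprimality.1-coprimeTo n))
ℕ→ℚ-mkℚ n = ℚₚ.↥p/↧p≡p (mkℚ (ℤ.+ n) 0 (Coprimality.sym (Coprimality.1-coprimeTo n)))

ℕ→ℚ-+ : ∀ m n → ℕ→ℚ (m ℕ.+ n) ≡ ℕ→ℚ m + ℕ→ℚ n
ℕ→ℚ-+ m n = sym (trans (cong₂ _+_ (ℕ→ℚ-mkℚ m) (ℕ→ℚ-mkℚ n))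
  (cong (_/ 1) (cong₂ ℤ._+_ (ℤₚ.*-identityʳ (ℤ.+ m)) (ℤₚ.*-identityʳ (ℤ.+ n)))))

ℕ→ℚ-* : ∀ m n → ℕ→ℚ (m ℕ.* n) ≡ ℕ→ℚ m * ℕ→ℚ n
ℕ→ℚ-* m n = sym (trans (cong₂ _*_ (ℕ→ℚ-mkℚ m) (ℕ→ℚ-mkℚ n))
  (cong (_/ 1) (sym (ℤₚ.pos-* m n))))

^-+ : ∀ x m n → x ^ℚ (m ℕ.+ n) ≡ x ^ℚ m * x ^ℚ n
^-+ x zero n = sym (ℚₚ.*-identityˡ (x ^ℚ n))
^-+ x (suc m) n = trans (cong (x *_) (^-+ x m n)) (sym (ℚₚ.*-assoc x (x ^ℚ m) (x ^ℚ n)))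

^-distribʳ-* : ∀ x y n → (x * y) ^ℚ n ≡ x ^ℚ n * y ^ℚ n
^-distribʳ-* x y zero = refl
^-distribʳ-* x y (suc n) = trans (cong (x * y *_) (^-distribʳ-* x y n))
  (solve 4 (λ a b c d → a :* b :* (c :* d) := a :* c :* (b :* d)) refl x y (x ^ℚ n) (y ^ℚ n))

1^ : ∀ n → 1ℚ ^ℚ n ≡ 1ℚ
1^ zero = refl
1^ (suc n) = trans (ℚₚ.*-identityˡ (1ℚ ^ℚ n)) (1^ n)

^-* : ∀ x m n → x ^ℚ (m ℕ.* n) ≡ (x ^ℚ m) ^ℚ n
^-* x zero n = sym (1^ n)
^-* x (suc m) n = trans (^-+ x n (m ℕ.* n))
  (trans (cong (x ^ℚ n *_) (^-* x m n)) (sym (^-distribʳ-* x (x ^ℚ m) n)))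

Σ<-cong : ∀ n {f g : ℕ → ℚ} → (∀ j → j < n → f j ≡ g j) → Σ< n f ≡ Σ< n g
Σ<-cong zero p = refl
Σ<-cong (suc n) p = cong₂ _+_ (Σ<-cong n (λ j j<n → p j (ℕₚ.m<n⇒m<1+n j<n))) (p n (ℕₚ.n<1+n n))

Σ<-suc : ∀ n (f : ℕ → ℚ) → Σ< (suc n) f ≡ f 0 + Σ< n (f ∘ suc)
Σ<-suc zero f = ℚₚ.+-comm 0ℚ (f 0)
Σ<-suc (suc n) f = trans (cong (_+ f (suc n)) (Σ<-suc n f)) (ℚₚ.+-assoc (f 0) (Σ< n (f ∘ suc)) (f (suc n)))

Σ<-+ : ∀ n (f g : ℕ → ℚ) → Σ< n (λ j → f j + g j) ≡ Σ< n f + Σ< n g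
Σ<-+ zero f g = refl
Σ<-+ (suc n) f g = trans (cong (_+ (f n + g n)) (Σ<-+ n f g))
  (solve 4 (λ a b c d → (a :+ b) :+ (c :+ d) := (a :+ c) :+ (b :+ d)) refl (Σ< n f) (Σ< n g) (f n) (g n))

Σ<-*ˡ : ∀ n c (f : ℕ → ℚ) → Σ< n (λ j → c * f j) ≡ c * Σ< n f
Σ<-*ˡ zero c f = sym (ℚₚ.*-zeroʳ c)
Σ<-*ˡ (suc n) c f = trans (cong (_+ c * f n) (Σ<-*ˡ n c f)) (sym (ℚₚ.*-distribˡ-+ c (Σ< n f) (f n)))

Σ<-zero : ∀ n → Σ< n (λ _ → 0ℚ) ≡ 0ℚ
Σ<-zero zero = refl
Σ<-zero (suc n) = cong (_+ 0ℚ) (Σ<-zero n)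

Σ<-swap : ∀ m n (f : ℕ → ℕ → ℚ) → Σ< m (λ i → Σ< n (f i)) ≡ Σ< n (λ j → Σ< m (λ i → f i j))
Σ<-swap zero n f = sym (Σ<-zero n)
Σ<-swap (suc m) n f = trans (cong (_+ Σ< n (f m)) (Σ<-swap m n f))
  (sym (Σ<-+ n (λ j → Σ< m (λ i → f i j)) (f m)))

Σ<-reverse : ∀ n (f : ℕ → ℚ) → Σ< n f ≡ Σ< n (λ j → f (n ∸ suc j))
Σ<-reverse zero f = refl
Σ<-reverse (suc n) f = trans (ℚₚ.+-comm (Σ< n f) (f n))
  (trans (cong (f n +_) (Σ<-reverse n f)) (sym (Σ<-suc n (λ j → f (n ∸ j)))))

Σ<-sum : ∀ n (f : ℕ → ℚ) → Σ< n f ≡ sum {n} (f ∘ toℕ)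
Σ<-sum zero f = refl
Σ<-sum (suc n) f = trans (Σ<-suc n f) (cong (f 0 +_) (Σ<-sum n (f ∘ suc)))

-- Bounds on all of ℕ let both maps restrict to `Fin n`, where they are mutually inverse and `sum`
-- is invariant under permutations.
Σ<-permute : ∀ n (σ τ : ℕ → ℕ) → (∀ j → σ j < n) → (∀ j → τ j < n) →
  (∀ j → j < n → σ (τ j) ≡ j) → (∀ j → j < n → τ (σ j) ≡ j) →
  ∀ (f : ℕ → ℚ) → Σ< n (f ∘ σ) ≡ Σ< n f
Σ<-permute n σ τ σ< τ< στ τσ f = begin
  Σ< n (f ∘ σ)                  ≡⟨ Σ<-sum n (f ∘ σ) ⟩
  sum {n} (f ∘ σ ∘ toℕ)         ≡⟨ sum-cong-≗ {n} (λ i → cong f (Finₚ.toℕ-fromℕ< (σ< (toℕ i)))) ⟨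
  sum {n} (f ∘ toℕ ∘ restrict σ σ<) ≡⟨ sum-permute {n} {n} (f ∘ toℕ) (permutation (restrict σ σ<) (restrict τ τ<) (inverse σ τ σ< τ< στ) (inverse τ σ τ< σ< τσ)) ⟨
  sum {n} (f ∘ toℕ)             ≡⟨ Σ<-sum n f ⟨
  Σ< n f ∎
  where
  open ≡-Reasoning
  restrict : (ρ : ℕ → ℕ) → (∀ j → ρ j < n) → Fin n → Fin n
  restrict ρ ρ< i = fromℕ< (ρ< (toℕ i))
  inverse : ∀ ρ π (ρ< : ∀ j → ρ j < n) (π< : ∀ j → π j < n) →
    (∀ j → j < n → ρ (π j) ≡ j) → ∀ i → restrict ρ ρ< (restrict π π< i) ≡ i
  inverse ρ π ρ< π< ρπ i = Finₚ.toℕ-injective (begin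
    toℕ (restrict ρ ρ< (restrict π π< i)) ≡⟨ Finₚ.toℕ-fromℕ< (ρ< _) ⟩
    ρ (toℕ (restrict π π< i))             ≡⟨ cong ρ (Finₚ.toℕ-fromℕ< (π< (toℕ i))) ⟩
    ρ (π (toℕ i))                         ≡⟨ ρπ (toℕ i) (Finₚ.toℕ<n i) ⟩
    toℕ i ∎)

-- Induction along the Leibniz rule: the two resulting sums differ by a shift of the index and merge
-- by Pascal's rule.
⊛-coeff : ∀ n f g → (f ⊛ g) n ≡ Σ< (suc n) (λ k → ℕ→ℚ (n C k) * (f k * g (n ∸ k)))
⊛-coeff zero f g = solve 1 (λ x → x := con 0ℚ :+ con 1ℚ :* x) refl (f 0 * g 0)
⊛-coeff (suc n) f g = begin
  (δ f ⊛ g) n + (f ⊛ δ g) n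
    ≡⟨ cong₂ _+_ (⊛-coeff n (δ f) g) (⊛-coeff n f (δ g)) ⟩
  Σ< (suc n) A + Σ< (suc n) (λ k → ℕ→ℚ (n C k) * (f k * g (suc (n ∸ k))))
    ≡⟨ cong (Σ< (suc n) A +_) (Σ<-cong (suc n) λ { k (s≤s k≤n) →
         cong (λ i → ℕ→ℚ (n C k) * (f k * g i)) (sym (ℕₚ.+-∸-assoc 1 k≤n)) }) ⟩
  Σ< (suc n) A + Σ< (suc n) B
    -- A vanishing term is appended, justified by C(n, n+1) = 0, so that the second sum gains a last
    -- term before its first one is split off.
    ≡⟨ cong (Σ< (suc n) A +_) (solve 2 (λ s x → s := s :+ con 0ℚ :* x) refl (Σ< (suc n) B) (f (suc n) * g (n ∸ n))) ⟩
  Σ< (suc n) A + (Σ< (suc n) B + 0ℚ * (f (suc n) * g (n ∸ n)))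
    ≡⟨ cong (λ z → Σ< (suc n) A + (Σ< (suc n) B + ℕ→ℚ z * (f (suc n) * g (n ∸ n)))) (k>n⇒nCk≡0 (ℕₚ.n<1+n n)) ⟨
  Σ< (suc n) A + Σ< (suc (suc n)) B
    ≡⟨ cong (Σ< (suc n) A +_) (Σ<-suc (suc n) B) ⟩
  Σ< (suc n) A + (B 0 + Σ< (suc n) (B ∘ suc))
    ≡⟨ solve 3 (λ a b c → a :+ (b :+ c) := b :+ (a :+ c)) refl (Σ< (suc n) A) (B 0) (Σ< (suc n) (B ∘ suc)) ⟩
  B 0 + (Σ< (suc n) A + Σ< (suc n) (B ∘ suc))
    ≡⟨ cong (B 0 +_) (Σ<-+ (suc n) A (B ∘ suc)) ⟨
  B 0 + Σ< (suc n) (λ k → A k + B (suc k))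
    ≡⟨ cong₂ _+_ (cong (λ z → ℕ→ℚ z * (f 0 * g (suc n))) (trans (nC0 n) (sym (nC0 (suc n))))) (Σ<-cong (suc n) λ k _ → pascal k) ⟩
  Bs 0 + Σ< (suc n) (Bs ∘ suc)
    ≡⟨ Σ<-suc (suc n) Bs ⟨
  Σ< (suc (suc n)) Bs ∎
  where
  open ≡-Reasoning
  A B Bs : ℕ → ℚ
  A k = ℕ→ℚ (n C k) * (f (suc k) * g (n ∸ k))
  B k = ℕ→ℚ (n C k) * (f k * g (suc n ∸ k))
  Bs k = ℕ→ℚ (suc n C k) * (f k * g (suc n ∸ k))
  nC0 : ∀ n → n C 0 ≡ 1
  nC0 n = trans (nCk≡nC[n∸k] {0} {n} z≤n) (nCn≡1 n)
  pascal : ∀ k → A k + B (suc k) ≡ Bs (suc k)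
  pascal k = trans (sym (ℚₚ.*-distribʳ-+ (f (suc k) * g (n ∸ k)) (ℕ→ℚ (n C k)) (ℕ→ℚ (n C suc k))))
    (cong (_* (f (suc k) * g (n ∸ k)))
      (trans (sym (ℕ→ℚ-+ (n C k) (n C suc k))) (cong ℕ→ℚ (nCk+nC[k+1]≡[n+1]C[k+1] n k))))

-- Finite sums of series, dilations and exponentials

∑ : ℕ → (ℕ → Series) → Series
∑ n f p = Σ< n (λ j → f j p)

∑-cong : ∀ n {f g : ℕ → Series} → (∀ j → j < n → f j ≈ g j) → ∑ n f ≈ ∑ n g
∑-cong n p .at k = Σ<-cong n (λ j j<n → at (p j j<n) k)

∑-⊕ : ∀ n (f g : ℕ → Series) → ∑ n (λ j → f j ⊕ g j) ≈ ∑ n f ⊕ ∑ n g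
∑-⊕ n f g .at k = Σ<-+ n (λ j → f j k) (λ j → g j k)

∑-suc : ∀ n (f : ℕ → Series) → ∑ (suc n) f ≈ f 0 ⊕ ∑ n (f ∘ suc)
∑-suc n f .at k = Σ<-suc n (λ j → f j k)

∑-⊛ˡ : ∀ n f (g : ℕ → Series) → ∑ n (λ j → f ⊛ g j) ≈ f ⊛ ∑ n g
∑-⊛ˡ zero f g = ≈-sym (≈-trans (⊛-cong {f} ≈-refl (pointwise λ n → sym (κ0≡0 n)))
  (≈-trans (CommutativeRing.zeroʳ seriesRing f) (pointwise κ0≡0)))
∑-⊛ˡ (suc n) f g = ≈-trans (⊕-cong (∑-⊛ˡ n f g) ≈-refl) (≈-sym (⊛-distribˡ-⊕ f (∑ n g) (g n)))

∑-zero : ∀ n {f : ℕ → Series} → (∀ j → j < n → f j ≈ κ 0ℚ) → ∑ n f ≈ κ 0ℚ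
∑-zero n p .at k = trans (Σ<-cong n (λ j j<n → trans (at (p j j<n) k) (κ0≡0 k)))
  (trans (Σ<-zero n) (sym (κ0≡0 k)))

·-∑ : ∀ n c (f : ℕ → Series) → ∑ n (λ j → c · f j) ≈ c · ∑ n f
·-∑ n c f .at p = Σ<-*ˡ n c (λ j → f j p)

-- The substitution t ↦ c t.
dilate : ℚ → Series → Series
dilate c f n = c ^ℚ n * f n

dilate-cong : ∀ c {f g} → f ≈ g → dilate c f ≈ dilate c g
dilate-cong c p .at n = cong (c ^ℚ n *_) (at p n)

dilate-κ : ∀ c x → dilate c (κ x) ≈ κ x
dilate-κ c x .at zero = ℚₚ.*-identityˡ x
dilate-κ c x .at (suc n) = ℚₚ.*-zeroʳ (c ^ℚ suc n)

dilate-⊕ : ∀ c f g → dilate c (f ⊕ g) ≈ dilate c f ⊕ dilate c g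
dilate-⊕ c f g .at n = ℚₚ.*-distribˡ-+ (c ^ℚ n) (f n) (g n)

-- Induction along the Leibniz rule, where the chain rule `δ-dilate` releases one factor `c` in each
-- summand.
dilate-⊛ : ∀ c f g → dilate c (f ⊛ g) ≈ dilate c f ⊛ dilate c g
dilate-⊛ c f g .at zero =
  solve 2 (λ x y → con 1ℚ :* (x :* y) := con 1ℚ :* x :* (con 1ℚ :* y)) refl (f 0) (g 0)
dilate-⊛ c f g .at (suc n) = begin
  c * c ^ℚ n * ((δ f ⊛ g) n + (f ⊛ δ g) n)
    ≡⟨ solve 4 (λ c d x y → c :* d :* (x :+ y) := c :* (d :* x) :+ c :* (d :* y)) refl
         c (c ^ℚ n) ((δ f ⊛ g) n) ((f ⊛ δ g) n) ⟩
  c * dilate c (δ f ⊛ g) n + c * dilate c (f ⊛ δ g) n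
    ≡⟨ cong₂ _+_ (cong (c *_) (at (dilate-⊛ c (δ f) g) n)) (cong (c *_) (at (dilate-⊛ c f (δ g)) n)) ⟩
  c * (dilate c (δ f) ⊛ dilate c g) n + c * (dilate c f ⊛ dilate c (δ g)) n
    ≡⟨ cong₂ _+_ (at (·-⊛ c (dilate c (δ f)) (dilate c g)) n) (at (·-⊛ʳ c (dilate c f) (dilate c (δ g))) n) ⟨
  ((c · dilate c (δ f)) ⊛ dilate c g) n + (dilate c f ⊛ (c · dilate c (δ g))) n
    ≡⟨ cong₂ _+_ (at (⊛-cong (δ-dilate f) ≈-refl) n) (at (⊛-cong ≈-refl (δ-dilate g)) n) ⟨
  (δ (dilate c f) ⊛ dilate c g) n + (dilate c f ⊛ δ (dilate c g)) n ∎
  where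
  open ≡-Reasoning
  δ-dilate : ∀ h → δ (dilate c h) ≈ c · dilate c (δ h)
  δ-dilate h .at k = ℚₚ.*-assoc c (c ^ℚ k) (h (suc k))

exp : ℚ → Series
exp x n = x ^ℚ n

-- Both sides satisfy f′ = (x + y) f with constant term 1.
exp-⊛ : ∀ x y → exp x ⊛ exp y ≈ exp (x + y)
exp-⊛ x y .at zero = refl
exp-⊛ x y .at (suc n) = begin
  ((x · exp x) ⊛ exp y) n + (exp x ⊛ (y · exp y)) n
    ≡⟨ cong₂ _+_ (at (·-⊛ x (exp x) (exp y)) n)
         (trans (at (⊛-comm (exp x) (y · exp y)) n) (at (·-⊛ y (exp y) (exp x)) n)) ⟩
  x * (exp x ⊛ exp y) n + y * (exp y ⊛ exp x) n
    ≡⟨ cong₂ _+_ (cong (x *_) (at (exp-⊛ x y) n))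
         (cong (y *_) (trans (at (⊛-comm (exp y) (exp x)) n) (at (exp-⊛ x y) n))) ⟩
  x * exp (x + y) n + y * exp (x + y) n
    ≡⟨ ℚₚ.*-distribʳ-+ (exp (x + y) n) x y ⟨
  (x + y) * exp (x + y) n ∎
  where open ≡-Reasoning

dilate-exp : ∀ c x → dilate c (exp x) ≈ exp (c * x)
dilate-exp c x .at n = sym (^-distribʳ-* c x n)

-- Generating functions of the Euler polynomials

2ℚ : ℚ
2ℚ = 1ℚ + 1ℚ

one : Series
one = κ 1ℚ

sgn : ℕ → ℚ
sgn n = (- 1ℚ) ^ℚ n

sgn² : ∀ n → sgn n * sgn n ≡ 1ℚ
sgn² n = trans (sym (^-distribʳ-* (- 1ℚ) (- 1ℚ) n)) (1^ n)

signℤ-+ : ∀ n → signℤ (ℤ.+ n) ≡ sgn n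
signℤ-+ zero = refl
signℤ-+ (suc zero) = refl
signℤ-+ (suc (suc n)) = trans (signℤ-+ n)
  (solve 1 (λ x → x := con (- 1ℚ) :* (con (- 1ℚ) :* x)) refl (sgn n))

sgn-even : ∀ n → n % 2 ≡ 0 → sgn n ≡ 1ℚ
sgn-even zero _ = refl
sgn-even (suc (suc n)) p = cong (λ x → - 1ℚ * (- 1ℚ * x)) (sgn-even n p)

sgn-odd : ∀ n → n % 2 ≡ 1 → sgn n ≡ - 1ℚ
sgn-odd (suc zero) _ = refl
sgn-odd (suc (suc n)) p = cong (λ x → - 1ℚ * (- 1ℚ * x)) (sgn-odd n p)

-- (-eᵗ)ⁿ
w : ℕ → Series
w n = sgn n · exp (ℕ→ℚ n)

w-⊛ : ∀ m n → w m ⊛ w n ≈ w (m ℕ.+ n)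
w-⊛ m n = ≈-trans (·-⊛ (sgn m) (exp (ℕ→ℚ m)) (w n))
  (≈-trans (·-cong (sgn m) (·-⊛ʳ (sgn n) (exp (ℕ→ℚ m)) (exp (ℕ→ℚ n))))
  (pointwise λ p → trans (sym (ℚₚ.*-assoc (sgn m) (sgn n) _))
    (cong₂ _*_ (sym (^-+ (- 1ℚ) m n))
      (trans (at (exp-⊛ (ℕ→ℚ m) (ℕ→ℚ n)) p) (cong (_^ℚ p) (sym (ℕ→ℚ-+ m n)))))))

δ-w : ∀ n → δ (w n) ≈ ℕ→ℚ n · w n
δ-w n .at p = solve 3 (λ s x y → s :* (x :* y) := x :* (s :* y)) refl (sgn n) (ℕ→ℚ n) (ℕ→ℚ n ^ℚ p)

-- The first hypothesis makes `κ ½ ⊛ v` an inverse of `z`; quotients such as 2 / (eᵗ + 1) are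
-- handled by multiplying out and cancelling the denominator.
⊛-cancelʳ : ∀ {v z f g} → v ⊛ z ≈ κ 2ℚ → f ⊛ z ≈ g ⊛ z → f ≈ g
⊛-cancelʳ {v} {z} {f} {g} vz fz≈gz = ≈-trans (half f) (≈-trans (⊛-cong ≈-refl fz≈gz) (≈-sym (half g)))
  where
  half : ∀ h → h ≈ κ ½ ⊛ v ⊛ (h ⊛ z)
  half h = ≈-trans (solveR 1 (λ h → h ≋ K ½ ⊠ h ⊠ K 2ℚ) ≈-refl h)
    (≈-trans (⊛-cong {κ ½ ⊛ h} ≈-refl (≈-sym vz))
      (solveR 3 (λ h v z → K ½ ⊠ h ⊠ (v ⊠ z) ≋ K ½ ⊠ v ⊠ (h ⊠ z)) ≈-refl h v z))

zipWith-applyUpTo : ∀ {A B C : Set} (h : A → B → C) (f : ℕ → A) (g : ℕ → B) n →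
  zipWith h (applyUpTo f n) (applyUpTo g n) ≡ applyUpTo (λ k → h (f k) (g k)) n
zipWith-applyUpTo h f g zero = refl
zipWith-applyUpTo h f g (suc n) = cong (h (f 0) (g 0) ∷_) (zipWith-applyUpTo h (f ∘ suc) (g ∘ suc) n)

sumℚ-applyUpTo : ∀ (f : ℕ → ℚ) n → sumℚ (applyUpTo f n) ≡ Σ< n f
sumℚ-applyUpTo f zero = refl
sumℚ-applyUpTo f (suc n) = trans (cong (f 0 +_) (sumℚ-applyUpTo (f ∘ suc) n)) (sym (Σ<-suc n f))

eulerList-applyUpTo : ∀ n x → eulerList n x ≡ applyUpTo (λ k → E k x) n
eulerList-applyUpTo zero x = refl
eulerList-applyUpTo (suc n) x = trans (cong (_++ (E n x ∷ [])) (eulerList-applyUpTo n x))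
  (applyUpTo-∷ʳ (λ k → E k x) n)

E-rec : ∀ n x → E n x ≡ x ^ℚ n - ½ * Σ< n (λ k → ℕ→ℚ (n C k) * E k x)
E-rec n x = cong (λ s → x ^ℚ n - ½ * s) (begin
  sumℚ (zipWith h (upTo n) (eulerList n x))              ≡⟨ cong (λ l → sumℚ (zipWith h (upTo n) l)) (eulerList-applyUpTo n x) ⟩
  sumℚ (zipWith h (upTo n) (applyUpTo (λ k → E k x) n))  ≡⟨ cong sumℚ (zipWith-applyUpTo h (λ k → k) (λ k → E k x) n) ⟩
  sumℚ (applyUpTo (λ k → h k (E k x)) n)                 ≡⟨ sumℚ-applyUpTo (λ k → h k (E k x)) n ⟩
  Σ< n (λ k → h k (E k x)) ∎)
  where
  open ≡-Reasoning
  h : ℕ → ℚ → ℚ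
  h k e = ℕ→ℚ (n C k) * e

eulerSeries : ℚ → Series
eulerSeries x n = E n x

-- In the n-th coefficient the factor eᵗ contributes the sum of C(n, k) E_k(x) over k ≤ n. Its last
-- term is a second E_n(x), and the recurrence for E_n(x) cancels the others.
eulerSeries-gf : ∀ x → eulerSeries x ⊛ (one ⊕ exp 1ℚ) ≈ κ 2ℚ ⊛ exp x
eulerSeries-gf x = ≈-trans
  (solveR 2 (λ e z → e ⊠ (K 1ℚ ⊞ z) ≋ e ⊞ e ⊠ z) ≈-refl (eulerSeries x) (exp 1ℚ))
  (≈-trans (pointwise coeff) (≈-sym (κ-⊛ 2ℚ (exp x))))
  where
  open ≡-Reasoning
  coeff : ∀ n → E n x + (eulerSeries x ⊛ exp 1ℚ) n ≡ 2ℚ * x ^ℚ n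
  coeff n = begin
    E n x + (eulerSeries x ⊛ exp 1ℚ) n
      ≡⟨ cong (E n x +_) (trans (⊛-coeff n (eulerSeries x) (exp 1ℚ)) (Σ<-cong (suc n) λ k _ →
           cong (ℕ→ℚ (n C k) *_) (trans (cong (E k x *_) (1^ (n ∸ k))) (ℚₚ.*-identityʳ (E k x))))) ⟩
    E n x + (s + ℕ→ℚ (n C n) * E n x)
      ≡⟨ cong (λ c → E n x + (s + ℕ→ℚ c * E n x)) (nCn≡1 n) ⟩
    E n x + (s + 1ℚ * E n x)
      ≡⟨ cong (λ e → e + (s + 1ℚ * e)) (E-rec n x) ⟩
    (x ^ℚ n - ½ * s) + (s + 1ℚ * (x ^ℚ n - ½ * s))
      ≡⟨ solve 2 (λ y s → (y :- con ½ :* s) :+ (s :+ con 1ℚ :* (y :- con ½ :* s)) := con 2ℚ :* y) refl (x ^ℚ n) s ⟩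
    2ℚ * x ^ℚ n ∎
    where
    s = Σ< n (λ k → ℕ→ℚ (n C k) * E k x)

u : Series
u = eulerSeries 0ℚ

exp0 : exp 0ℚ ≈ one
exp0 .at zero = refl
exp0 .at (suc n) = ℚₚ.*-zeroˡ (0ℚ ^ℚ n)

u-gf : u ⊛ (one ⊕ exp 1ℚ) ≈ κ 2ℚ
u-gf = ≈-trans (eulerSeries-gf 0ℚ) (≈-trans (⊛-cong ≈-refl exp0)
  (solveR 0 (K 2ℚ ⊠ K 1ℚ ≋ K 2ℚ) ≈-refl))

eulerSeries-exp : ∀ x → eulerSeries x ≈ u ⊛ exp x
eulerSeries-exp x = ⊛-cancelʳ u-gf (≈-trans (eulerSeries-gf x) (≈-sym
  (≈-trans (solveR 3 (λ u e z → u ⊠ e ⊠ z ≋ u ⊠ z ⊠ e) ≈-refl u (exp x) (one ⊕ exp 1ℚ))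
    (⊛-cong u-gf ≈-refl))))

dilate-u-gf : ∀ c → dilate c u ⊛ (one ⊕ exp c) ≈ κ 2ℚ
dilate-u-gf c = ≈-trans (⊛-cong {dilate c u} ≈-refl (≈-sym
    (≈-trans (dilate-⊕ c one (exp 1ℚ)) (⊕-cong (dilate-κ c 1ℚ)
      (≈-trans (dilate-exp c 1ℚ) (pointwise λ n → cong (_^ℚ n) (ℚₚ.*-identityʳ c)))))))
  (≈-trans (≈-sym (dilate-⊛ c u (one ⊕ exp 1ℚ))) (≈-trans (dilate-cong c u-gf) (dilate-κ c 2ℚ)))

-- 2 / (e⁻ᵗ + 1) = 2 eᵗ / (eᵗ + 1), checked by multiplying with 1 + eᵗ = (1 + e⁻ᵗ) eᵗ.
u-reflect : dilate (- 1ℚ) u ≈ u ⊛ exp 1ℚ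
u-reflect = ⊛-cancelʳ u-gf (≈-trans
  (⊛-cong {dilate (- 1ℚ) u} ≈-refl
    (≈-trans (⊕-cong (≈-trans (≈-sym exp0) (≈-sym (exp-⊛ (- 1ℚ) 1ℚ))) ≈-refl)
      (solveR 2 (λ x y → x ⊠ y ⊞ y ≋ (K 1ℚ ⊞ x) ⊠ y) ≈-refl (exp (- 1ℚ)) (exp 1ℚ))))
  (≈-trans (≈-sym (⊛-assoc (dilate (- 1ℚ) u) (one ⊕ exp (- 1ℚ)) (exp 1ℚ)))
  (≈-trans (⊛-cong (≈-trans (dilate-u-gf (- 1ℚ)) (≈-sym u-gf)) ≈-refl)
    (solveR 3 (λ u e z → u ⊠ z ⊠ e ≋ u ⊠ e ⊠ z) ≈-refl u (exp 1ℚ) (one ⊕ exp 1ℚ)))))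

double-zero : ∀ x → x + x ≡ 0ℚ → x ≡ 0ℚ
double-zero x p = trans (solve 1 (λ x → x := con ½ :* (x :+ x)) refl x)
  (cong (½ *_) p)

-- For even `p` the reflection makes the p-th coefficients of `u` and u eᵗ equal, while the sum of
-- the two series is the constant 2.
E-even-zero : ∀ p → p % 2 ≡ 0 → NonZero p → E p 0ℚ ≡ 0ℚ
E-even-zero p@(suc _) even _ = double-zero (u p) (begin
  u p + u p                     ≡⟨ cong (u p +_) (trans (cong (_* u p) (sgn-even p even)) (ℚₚ.*-identityˡ (u p))) ⟨
  u p + sgn p * u p             ≡⟨ cong (u p +_) (at u-reflect p) ⟩
  u p + (u ⊛ exp 1ℚ) p          ≡⟨ at (solveR 2 (λ u z → u ⊞ u ⊠ z ≋ u ⊠ (K 1ℚ ⊞ z)) ≈-refl u (exp 1ℚ)) p ⟩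
  (u ⊛ (one ⊕ exp 1ℚ)) p        ≡⟨ at u-gf p ⟩
  0ℚ ∎)
  where open ≡-Reasoning

-- 2 / (e^{nt} + 1)
U : ℕ → Series
U n = dilate (ℕ→ℚ n) u

exp≈w : ∀ n → n % 2 ≡ 1 → exp (ℕ→ℚ n) ≈ ⊖ w n
exp≈w n odd .at p = sym (trans (cong (λ s → - (s * exp (ℕ→ℚ n) p)) (sgn-odd n odd))
  (solve 1 (λ x → :- (con (- 1ℚ) :* x) := x) refl (exp (ℕ→ℚ n) p)))

U-gf : ∀ n → n % 2 ≡ 1 → U n ⊛ (one ⊕ ⊖ w n) ≈ κ 2ℚ
U-gf n odd = ≈-trans (⊛-cong {U n} ≈-refl (⊕-cong {one} ≈-refl (≈-sym (exp≈w n odd)))) (dilate-u-gf (ℕ→ℚ n))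

-- The E_p(y) have the generating function u e^{yt}, and replacing t by b t turns it into U_b
-- e^{rt}. The hypothesis states y = r/b without a division.
E-dilate : ∀ b r y → y * ℕ→ℚ b ≡ ℕ→ℚ r → ∀ p → sgn r * (ℕ→ℚ b ^ℚ p * E p y) ≡ (U b ⊛ w r) p
E-dilate b r y yb≡r p = sym (trans (at (·-⊛ʳ (sgn r) (U b) (exp (ℕ→ℚ r))) p)
  (cong (sgn r *_) (sym (at eq p))))
  where
  eq : dilate (ℕ→ℚ b) (eulerSeries y) ≈ U b ⊛ exp (ℕ→ℚ r)
  eq = ≈-trans (dilate-cong (ℕ→ℚ b) (eulerSeries-exp y))
    (≈-trans (dilate-⊛ (ℕ→ℚ b) u (exp y)) (⊛-cong ≈-refl
      (≈-trans (dilate-exp (ℕ→ℚ b) y)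
        (pointwise λ n → cong (_^ℚ n) (trans (ℚₚ.*-comm (ℕ→ℚ b) y) yb≡r)))))

-- Quasi-periodic Euler functions at rational arguments

/-*-cancel : ∀ x b .{{_ : NonZero b}} → ((ℤ.+ x) / b) * ℕ→ℚ b ≡ ℕ→ℚ x
/-*-cancel x b@(suc b-1) = ℚₚ.toℚᵘ-injective (ℚᵘₚ.≃-trans (ℚₚ.toℚᵘ-homo-* ((ℤ.+ x) / b) (ℕ→ℚ b))
  (ℚᵘₚ.≃-trans (ℚᵘₚ.*-cong (ℚₚ.toℚᵘ-fromℚᵘ (ℚᵘ.mkℚᵘ (ℤ.+ x) b-1)) (ℚₚ.toℚᵘ-fromℚᵘ (ℚᵘ.mkℚᵘ (ℤ.+ b) 0)))
  (ℚᵘₚ.≃-trans (ℚᵘ.*≡* (trans (ℤₚ.*-identityʳ ((ℤ.+ x) ℤ.* (ℤ.+ b))) (cong ((ℤ.+ x) ℤ.*_) (sym (ℤₚ.*-identityʳ (ℤ.+ b))))))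
    (ℚᵘₚ.≃-sym (ℚₚ.toℚᵘ-fromℚᵘ (ℚᵘ.mkℚᵘ (ℤ.+ x) 0))))))

floor-mkℚ+ : ∀ n d .{{_ : NonZero d}} .(c : Coprime n d) → floor (mkℚ+ n d c) ≡ ℤ.+ (n ℕ./ d)
floor-mkℚ+ n (suc d) c = ℤₚ.*-identityˡ (ℤ.+ (n ℕ./ suc d))

-- The fraction is stored in lowest terms, so `floor` divides x/g by b/g with g the gcd; the common
-- factor does not affect the integer quotient.
floor-/ : ∀ x b .{{_ : NonZero b}} → floor ((ℤ.+ x) / b) ≡ ℤ.+ (x ℕ./ b)
floor-/ x b = trans (floor-mkℚ+ (x ℕ./ g) (b ℕ./ g) (Coprimality.coprime-/gcd x b)) (cong ℤ.+_ (begin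
  x ℕ./ g ℕ./ (b ℕ./ g)     ≡⟨ ℕ/.m/n/o≡m/[n*o] x g (b ℕ./ g) ⟩
  x ℕ./ (g ℕ.* (b ℕ./ g))   ≡⟨ ℕ/./-congʳ (ℕ/.m*[n/m]≡n (gcd[m,n]∣n x b)) ⟩
  x ℕ./ b ∎))
  where
  open ≡-Reasoning
  g = gcd x b
  instance
    g≢0 : NonZero g
    g≢0 = ℕ.≢-nonZero (gcd[m,n]≢0 x b (inj₂ (ℕ.≢-nonZero⁻¹ b)))
    b/g≢0 : NonZero (b ℕ./ g)
    b/g≢0 = ℕ.≢-nonZero (n/gcd[m,n]≢0 x b {{gcd≢0 = g≢0}})
    g*[b/g]≢0 : NonZero (g ℕ.* (b ℕ./ g))
    g*[b/g]≢0 = ℕₚ.m*n≢0 g (b ℕ./ g)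

frac : ℕ → (b : ℕ) → .{{NonZero b}} → ℚ
frac x b = (ℤ.+ x) / b - ℤ→ℚ (ℤ.+ (x ℕ./ b))

frac-* : ∀ x b .{{_ : NonZero b}} → frac x b * ℕ→ℚ b ≡ ℕ→ℚ (x % b)
frac-* x b = begin
  (y - ℕ→ℚ q) * ℕ→ℚ b             ≡⟨ solve 3 (λ y q b → (y :- q) :* b := y :* b :- q :* b) refl y (ℕ→ℚ q) (ℕ→ℚ b) ⟩
  y * ℕ→ℚ b - ℕ→ℚ q * ℕ→ℚ b       ≡⟨ cong₂ _-_ (/-*-cancel x b) (sym (ℕ→ℚ-* q b)) ⟩
  ℕ→ℚ x - ℕ→ℚ (q ℕ.* b)           ≡⟨ cong (λ z → ℕ→ℚ z - ℕ→ℚ (q ℕ.* b)) (ℕ/.m≡m%n+[m/n]*n x b) ⟩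
  ℕ→ℚ (x % b ℕ.+ q ℕ.* b) - ℕ→ℚ (q ℕ.* b)
    ≡⟨ cong (_- ℕ→ℚ (q ℕ.* b)) (ℕ→ℚ-+ (x % b) (q ℕ.* b)) ⟩
  ℕ→ℚ (x % b) + ℕ→ℚ (q ℕ.* b) - ℕ→ℚ (q ℕ.* b)
    ≡⟨ solve 2 (λ r z → r :+ z :- z := r) refl (ℕ→ℚ (x % b)) (ℕ→ℚ (q ℕ.* b)) ⟩
  ℕ→ℚ (x % b) ∎
  where
  open ≡-Reasoning
  y = (ℤ.+ x) / b
  q = x ℕ./ b

Ebar-/ : ∀ p x b .{{_ : NonZero b}} → Ebar p ((ℤ.+ x) / b) ≡ sgn (x ℕ./ b) * E p (frac x b)
Ebar-/ p x b = trans (cong (λ z → signℤ z * E p ((ℤ.+ x) / b - ℤ→ℚ z)) (floor-/ x b))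
  (cong (_* E p (frac x b)) (signℤ-+ (x ℕ./ b)))

sgn-odd-* : ∀ a j → a % 2 ≡ 1 → sgn (a ℕ.* j) ≡ sgn j
sgn-odd-* a j odd = trans (^-* (- 1ℚ) a j) (cong (_^ℚ j) (sgn-odd a odd))

-- With a j = r + q b and a, b odd, j and r + q have the same parity. The sign of the summand and
-- that of the quasi-periodic function thus combine to the sign in `w r`.
sgn-remainder : ∀ a b j .{{_ : NonZero b}} → a % 2 ≡ 1 → b % 2 ≡ 1 →
  sgn j * sgn ((a ℕ.* j) ℕ./ b) ≡ sgn ((a ℕ.* j) % b)
sgn-remainder a b j odda oddb = begin
  sgn j * sgn q               ≡⟨ cong (_* sgn q) (sgn-odd-* a j odda) ⟨
  sgn (a ℕ.* j) * sgn q       ≡⟨ cong (λ z → sgn z * sgn q) (ℕ/.m≡m%n+[m/n]*n (a ℕ.* j) b) ⟩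
  sgn (r ℕ.+ q ℕ.* b) * sgn q ≡⟨ cong (_* sgn q) (trans (^-+ (- 1ℚ) r (q ℕ.* b))
                                   (cong (sgn r *_) (trans (cong sgn (ℕₚ.*-comm q b)) (sgn-odd-* b q oddb)))) ⟩
  sgn r * sgn q * sgn q       ≡⟨ ℚₚ.*-assoc (sgn r) (sgn q) (sgn q) ⟩
  sgn r * (sgn q * sgn q)     ≡⟨ cong (sgn r *_) (sgn² q) ⟩
  sgn r * 1ℚ                  ≡⟨ ℚₚ.*-identityʳ (sgn r) ⟩
  sgn r ∎
  where
  open ≡-Reasoning
  q = (a ℕ.* j) ℕ./ b
  r = (a ℕ.* j) % b

-- E_1(y) = y - ½, and the floor is 0 for j < b; the factor 2 b clears the denominators.
Ebar₁-/ : ∀ j b .{{_ : NonZero b}} → j < b →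
  ℕ→ℚ b * (ℕ→ℚ 2 * Ebar 1 ((ℤ.+ j) / b)) ≡ ℕ→ℚ 2 * ℕ→ℚ j - ℕ→ℚ b
Ebar₁-/ j b j<b = begin
  ℕ→ℚ b * (ℕ→ℚ 2 * Ebar 1 ((ℤ.+ j) / b))
    ≡⟨ cong (λ e → ℕ→ℚ b * (ℕ→ℚ 2 * e)) (Ebar-/ 1 j b) ⟩
  ℕ→ℚ b * (ℕ→ℚ 2 * (sgn (j ℕ./ b) * E 1 y))
    ≡⟨ cong (λ q → ℕ→ℚ b * (ℕ→ℚ 2 * (sgn q * E 1 y))) (ℕ/.m<n⇒m/n≡0 j<b) ⟩
  ℕ→ℚ b * (ℕ→ℚ 2 * (1ℚ * E 1 y))
    ≡⟨ solve 2 (λ b y → b :* (con (ℕ→ℚ 2) :* (con 1ℚ :* (y :* con 1ℚ :- con ½))) := con (ℕ→ℚ 2) :* (y :* b) :- b) refl (ℕ→ℚ b) y ⟩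
  ℕ→ℚ 2 * (y * ℕ→ℚ b) - ℕ→ℚ b
    ≡⟨ cong (λ z → ℕ→ℚ 2 * z - ℕ→ℚ b) (trans (frac-* j b) (cong ℕ→ℚ (ℕ/.m<n⇒m%n≡m j<b))) ⟩
  ℕ→ℚ 2 * ℕ→ℚ j - ℕ→ℚ b ∎
  where
  open ≡-Reasoning
  y = frac j b

-- The j-th summand of b T_p(a, b), for all p at once and with t rescaled to bt.
term : (a b : ℕ) → .{{NonZero b}} → ℕ → Series
term a b j = (ℕ→ℚ 2 * ℕ→ℚ j - ℕ→ℚ b) · (U b ⊛ w ((a ℕ.* j) % b))

-- The factor b^p turns the value of E_p into a coefficient of `U b ⊛ w r`; the remaining b, with
-- the 2 in front of the sum, turns the value of E_1 into the integer 2j - b.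
T-series : ∀ a b .{{_ : NonZero b}} → a % 2 ≡ 1 → b % 2 ≡ 1 → ∀ p →
  ℕ→ℚ b ^ℚ suc p * T p a b ≡ ∑ b (term a b) p
T-series a b odda oddb p = begin
  ℕ→ℚ b * ℕ→ℚ b ^ℚ p * (ℕ→ℚ 2 * Σ< b t)
    ≡⟨ ℚₚ.*-assoc (ℕ→ℚ b * ℕ→ℚ b ^ℚ p) (ℕ→ℚ 2) (Σ< b t) ⟨
  ℕ→ℚ b * ℕ→ℚ b ^ℚ p * ℕ→ℚ 2 * Σ< b t
    ≡⟨ Σ<-*ˡ b (ℕ→ℚ b * ℕ→ℚ b ^ℚ p * ℕ→ℚ 2) t ⟨
  Σ< b (λ j → ℕ→ℚ b * ℕ→ℚ b ^ℚ p * ℕ→ℚ 2 * t j)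
    ≡⟨ Σ<-cong b step ⟩
  ∑ b (term a b) p ∎
  where
  open ≡-Reasoning
  t : ℕ → ℚ
  t j = signℤ (ℤ.+ j) * Ebar p ((ℤ.+ (a ℕ.* j)) / b) * Ebar 1 ((ℤ.+ j) / b)
  step : ∀ j → j < b → ℕ→ℚ b * ℕ→ℚ b ^ℚ p * ℕ→ℚ 2 * t j ≡ term a b j p
  step j j<b = begin
    ℕ→ℚ b * bᵖ * ℕ→ℚ 2 * (signℤ (ℤ.+ j) * Ebar p ((ℤ.+ (a ℕ.* j)) / b) * e₁)
      ≡⟨ cong₂ (λ s e → ℕ→ℚ b * bᵖ * ℕ→ℚ 2 * (s * e * e₁)) (signℤ-+ j) (Ebar-/ p (a ℕ.* j) b) ⟩
    ℕ→ℚ b * bᵖ * ℕ→ℚ 2 * (sgn j * (sgn q * e) * e₁)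
      ≡⟨ solve 7 (λ b c d s r e f → b :* c :* d :* (s :* (r :* e) :* f) := b :* (d :* f) :* (s :* r :* (c :* e))) refl
           (ℕ→ℚ b) bᵖ (ℕ→ℚ 2) (sgn j) (sgn q) e e₁ ⟩
    ℕ→ℚ b * (ℕ→ℚ 2 * e₁) * (sgn j * sgn q * (bᵖ * e))
      ≡⟨ cong₂ (λ x s → x * (s * (bᵖ * e))) (Ebar₁-/ j b j<b) (sgn-remainder a b j odda oddb) ⟩
    (ℕ→ℚ 2 * ℕ→ℚ j - ℕ→ℚ b) * (sgn r * (bᵖ * e))
      ≡⟨ cong ((ℕ→ℚ 2 * ℕ→ℚ j - ℕ→ℚ b) *_) (E-dilate b r (frac (a ℕ.* j) b) (frac-* (a ℕ.* j) b) p) ⟩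
    term a b j p ∎
    where
    bᵖ = ℕ→ℚ b ^ℚ p
    q = (a ℕ.* j) ℕ./ b
    r = (a ℕ.* j) % b
    e = E p (frac (a ℕ.* j) b)
    e₁ = Ebar 1 ((ℤ.+ j) / b)

-- Lattice point sums

-- w (x ∸ y) if y ≤ x, and 0 otherwise
χ : ℕ → ℕ → Series
χ x zero = w x
χ zero (suc y) = κ 0ℚ
χ (suc x) (suc y) = χ x y

χ-shift : ∀ z x y → χ (z ℕ.+ x) (z ℕ.+ y) ≡ χ x y
χ-shift zero x y = refl
χ-shift (suc z) x y = χ-shift z x y

χ-zero : ∀ {x y} → x < y → χ x y ≡ κ 0ℚ
χ-zero {zero} {suc y} _ = refl
χ-zero {suc x} {suc y} (s≤s x<y) = χ-zero x<y

-- Reflection in `c` preserves the difference x - y as well as the condition y ≤ x.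
χ-reflect : ∀ c x y → x ≤ c → y ≤ c → χ (c ∸ y) (c ∸ x) ≡ χ x y
χ-reflect c x zero x≤c _ = begin
  χ c (c ∸ x)                         ≡⟨ cong₂ χ (ℕₚ.m∸n+n≡m x≤c) (ℕₚ.+-identityʳ (c ∸ x)) ⟨
  χ (c ∸ x ℕ.+ x) (c ∸ x ℕ.+ 0)       ≡⟨ χ-shift (c ∸ x) x 0 ⟩
  w x ∎
  where open ≡-Reasoning
χ-reflect (suc c) zero (suc y) _ _ = χ-zero (s≤s (ℕₚ.m∸n≤m c y))
χ-reflect (suc c) (suc x) (suc y) (s≤s p) (s≤s q) = χ-reflect c x y p q

-- For y ≤ x this differentiates (-eᵗ)^{x-y}; for y > x both sides vanish, so the factor needs no
-- case distinction.
δ-χ : ∀ x y → δ (χ x y) ≈ (ℕ→ℚ x - ℕ→ℚ y) · χ x y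
δ-χ x zero .at p = trans (at (δ-w x) p)
  (cong (_* w x p) (solve 1 (λ z → z := z :- con 0ℚ) refl (ℕ→ℚ x)))
δ-χ zero (suc y) .at p = sym (trans (cong ((ℕ→ℚ 0 - ℕ→ℚ (suc y)) *_) (κ0≡0 p)) (ℚₚ.*-zeroʳ (ℕ→ℚ 0 - ℕ→ℚ (suc y))))
δ-χ (suc x) (suc y) .at p = trans (at (δ-χ x y) p) (cong (_* χ x y p)
  (trans (solve 2 (λ x y → x :- y := (con 1ℚ :+ x) :- (con 1ℚ :+ y)) refl (ℕ→ℚ x) (ℕ→ℚ y))
    (cong₂ _-_ (sym (ℕ→ℚ-+ 1 x)) (sym (ℕ→ℚ-+ 1 y)))))

-- Induction on `q`: by U_b (1 - w^b) = 2, raising the exponent x by b costs 2 w^x. The bound `M`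
-- may exceed `q` because multiples of b beyond q b give vanishing terms; one `M` for all j then
-- makes the range of the lattice sum a rectangle.
U-expand : ∀ b .{{_ : NonZero b}} → b % 2 ≡ 1 → ∀ r q M → r < b → q ≤ M →
  U b ⊛ w r ≈ U b ⊛ w (q ℕ.* b ℕ.+ r) ⊕ κ 2ℚ ⊛ ∑ M (λ m → χ (q ℕ.* b ℕ.+ r) (suc m ℕ.* b))
U-expand b odd r zero M r<b _ = ≈-sym (≈-trans
  (⊕-cong {U b ⊛ w r} ≈-refl (⊛-cong {κ 2ℚ} ≈-refl (∑-zero M λ m _ →
    ≈-reflexive (χ-zero (ℕₚ.<-≤-trans r<b (ℕₚ.m≤m+n b (m ℕ.* b)))))))
  (solveR 1 (λ x → x ⊞ K 2ℚ ⊠ K 0ℚ ≋ x) ≈-refl (U b ⊛ w r)))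
U-expand b odd r (suc q) (suc M) r<b (s≤s q≤M) = ≈-trans (U-expand b odd r q M r<b q≤M)
  (≈-trans (⊕-cong step ≈-refl)
  (≈-trans (solveR 3 (λ x y s → x ⊞ K 2ℚ ⊠ y ⊞ K 2ℚ ⊠ s ≋ x ⊞ K 2ℚ ⊠ (y ⊞ s)) ≈-refl
              (U b ⊛ w (b ℕ.+ x)) (w x) (∑ M (λ m → χ x (suc m ℕ.* b))))
    (≈-trans (⊕-cong {U b ⊛ w (b ℕ.+ x)} ≈-refl (⊛-cong {κ 2ℚ} ≈-refl sums)) (pointwise λ p →
      cong (λ z → (U b ⊛ w z ⊕ κ 2ℚ ⊛ ∑ (suc M) (λ m → χ z (suc m ℕ.* b))) p) (sym (ℕₚ.+-assoc b (q ℕ.* b) r))))))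
  where
  x = q ℕ.* b ℕ.+ r
  step : U b ⊛ w x ≈ U b ⊛ w (b ℕ.+ x) ⊕ κ 2ℚ ⊛ w x
  step = ≈-sym (≈-trans (⊕-cong (⊛-cong {U b} ≈-refl (≈-sym (w-⊛ b x))) (⊛-cong {g = w x} (≈-sym (U-gf b odd)) ≈-refl))
    (solveR 3 (λ u v x → u ⊠ (v ⊠ x) ⊞ u ⊠ (K 1ℚ ⊞ ⊟ v) ⊠ x ≋ u ⊠ x) ≈-refl (U b) (w b) (w x)))
  -- Passing to the exponent b + x shifts the sum by one index, and the new first term is `w x`.
  sums : w x ⊕ ∑ M (λ m → χ x (suc m ℕ.* b)) ≈ ∑ (suc M) (λ m → χ (b ℕ.+ x) (suc m ℕ.* b))
  sums = ≈-sym (≈-trans (∑-suc M (λ m → χ (b ℕ.+ x) (suc m ℕ.* b)))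
    (⊕-cong (≈-reflexive (χ-shift b x 0))
      (∑-cong M λ m _ → ≈-reflexive (χ-shift b x (suc m ℕ.* b)))))

-- χ restricts the double sum to 0 < m b ≤ a j (with m and j shifted by one).
residue-sum : ∀ a′ b′ (let a = suc a′; b = suc b′) → b % 2 ≡ 1 → (c : ℕ → ℚ) →
  ∑ b (λ j → c j · (U b ⊛ w ((a ℕ.* j) % b)))
    ≈ U b ⊛ ∑ b (λ j → c j · w (a ℕ.* j))
      ⊕ κ 2ℚ ⊛ ∑ b′ (λ j → ∑ a′ (λ m → c (suc j) · χ (a ℕ.* suc j) (suc m ℕ.* b)))
residue-sum a′ b′ odd c =
  ≈-trans (∑-cong b expand)
  (≈-trans (∑-⊕ b (λ j → U b ⊛ (c j · w (a ℕ.* j))) (λ j → κ 2ℚ ⊛ inner j))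
  (⊕-cong (∑-⊛ˡ b (U b) (λ j → c j · w (a ℕ.* j)))
    (≈-trans (∑-⊛ˡ b (κ 2ℚ) inner) (⊛-cong {κ 2ℚ} ≈-refl
      (≈-trans (∑-suc b′ inner)
        (≈-trans (⊕-cong inner0 ≈-refl) (CommutativeRing.+-identityˡ seriesRing (∑ b′ (inner ∘ suc)))))))))
  where
  a = suc a′
  b = suc b′
  inner : ℕ → Series
  inner j = ∑ a′ (λ m → c j · χ (a ℕ.* j) (suc m ℕ.* b))
  -- The row j = 0 contains no lattice point, since 0 < (m + 1) b.
  inner0 : inner 0 ≈ κ 0ℚ
  inner0 = ∑-zero a′ λ m _ → pointwise λ p → trans
    (cong (c 0 *_) (trans (cong (λ z → χ z (suc m ℕ.* b) p) (ℕₚ.*-zeroʳ a)) (κ0≡0 p)))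
    (trans (ℚₚ.*-zeroʳ (c 0)) (sym (κ0≡0 p)))
  expand : ∀ j → j < b → c j · (U b ⊛ w ((a ℕ.* j) % b)) ≈ U b ⊛ (c j · w (a ℕ.* j)) ⊕ κ 2ℚ ⊛ inner j
  expand j j<b = ≈-trans (·-cong (c j) (≈-trans
      (U-expand b odd ((a ℕ.* j) % b) ((a ℕ.* j) ℕ./ b) a′ (ℕ/.m%n<n (a ℕ.* j) b)
        -- From j < b follows a j < a b, so the quotient is at most a - 1, which is `a′`.
        (ℕₚ.<⇒≤pred (ℕ/.m<n*o⇒m/o<n (ℕₚ.*-monoʳ-< a j<b))))
      (pointwise λ p → cong (λ z → (U b ⊛ w z ⊕ κ 2ℚ ⊛ ∑ a′ (λ m → χ z (suc m ℕ.* b))) p)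
        (sym (trans (ℕ/.m≡m%n+[m/n]*n (a ℕ.* j) b) (ℕₚ.+-comm ((a ℕ.* j) % b) _))))))
    (≈-trans (·-⊕ (c j) (U b ⊛ w (a ℕ.* j)) (κ 2ℚ ⊛ ∑ a′ (λ m → χ (a ℕ.* j) (suc m ℕ.* b))))
      (⊕-cong (≈-sym (·-⊛ʳ (c j) (U b) (w (a ℕ.* j))))
        (≈-trans (≈-sym (·-⊛ʳ (c j) (κ 2ℚ) (∑ a′ (λ m → χ (a ℕ.* j) (suc m ℕ.* b)))))
          (⊛-cong {κ 2ℚ} ≈-refl (≈-sym (·-∑ a′ (c j) (λ m → χ (a ℕ.* j) (suc m ℕ.* b))))))))

-- Geometric sums and residues modulo b

geometric : ∀ a n → ∑ n (λ j → w (a ℕ.* j)) ⊛ (one ⊕ ⊖ w a) ≈ one ⊕ ⊖ w (a ℕ.* n)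
geometric a zero = ≈-trans (⊛-cong {g = one ⊕ ⊖ w a} (∑-zero 0 {λ _ → one} (λ j ())) ≈-refl)
  (≈-trans (solveR 1 (λ z → K 0ℚ ⊠ z ≋ K 1ℚ ⊞ ⊟ K 1ℚ) ≈-refl (one ⊕ ⊖ w a))
    (⊕-cong {one} ≈-refl (pointwise λ p → cong -_ (sym (trans (cong (λ z → w z p) (ℕₚ.*-zeroʳ a))
      (trans (ℚₚ.*-identityˡ (exp 0ℚ p)) (at exp0 p)))))))
geometric a (suc n) = ≈-trans
  (solveR 3 (λ s x v → (s ⊞ x) ⊠ (K 1ℚ ⊞ ⊟ v) ≋ s ⊠ (K 1ℚ ⊞ ⊟ v) ⊞ (x ⊞ ⊟ (v ⊠ x))) ≈-refl
    (∑ n (λ j → w (a ℕ.* j))) (w (a ℕ.* n)) (w a))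
  (≈-trans (⊕-cong {g = w (a ℕ.* n) ⊕ ⊖ (w a ⊛ w (a ℕ.* n))} (geometric a n) (⊕-cong {w (a ℕ.* n)} ≈-refl
      (pointwise λ p → cong -_ (trans (at (w-⊛ a (a ℕ.* n)) p) (cong (λ z → w z p) (sym (ℕₚ.*-suc a n)))))))
    (solveR 2 (λ x y → K 1ℚ ⊞ ⊟ x ⊞ (x ⊞ ⊟ y) ≋ K 1ℚ ⊞ ⊟ y) ≈-refl (w (a ℕ.* n)) (w (a ℕ.* suc n))))

-- `U a` inverts 1 - w^a up to the factor 2, so the telescoped identity can be solved for the sum.
geometric-U : ∀ a n → a % 2 ≡ 1 → ∑ n (λ j → w (a ℕ.* j)) ≈ κ ½ ⊛ (U a ⊛ (one ⊕ ⊖ w (a ℕ.* n)))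
geometric-U a n odd = ≈-trans (solveR 1 (λ s → s ≋ K ½ ⊠ (s ⊠ K 2ℚ)) ≈-refl s)
  (⊛-cong {κ ½} ≈-refl (≈-trans (⊛-cong {s} ≈-refl (≈-sym (U-gf a odd)))
    (≈-trans (solveR 3 (λ s u v → s ⊠ (u ⊠ v) ≋ u ⊠ (s ⊠ v)) ≈-refl s (U a) (one ⊕ ⊖ w a))
      (⊛-cong {U a} ≈-refl (geometric a n)))))
  where
  s = ∑ n (λ j → w (a ℕ.* j))

%-*ʳ : ∀ m n d .{{_ : NonZero d}} → (m ℕ.* (n % d)) % d ≡ (m ℕ.* n) % d
%-*ʳ m n d = begin
  (m ℕ.* (n % d)) % d             ≡⟨ ℕ/.%-distribˡ-* m (n % d) d ⟩
  ((m % d) ℕ.* (n % d % d)) % d   ≡⟨ cong (λ z → ((m % d) ℕ.* z) % d) (ℕ/.m%n%n≡m%n n d) ⟩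
  ((m % d) ℕ.* (n % d)) % d       ≡⟨ ℕ/.%-distribˡ-* m n d ⟨
  (m ℕ.* n) % d ∎
  where open ≡-Reasoning

modular-inverse : ∀ a b .{{_ : NonZero b}} → Coprime a b → Σ ℕ λ a⁻¹ → (a ℕ.* a⁻¹) % b ≡ 1 % b
modular-inverse a b@(suc b′) coprime with Coprimality.coprime-Bézout coprime
... | Bézout.+- x y 1+yb≡xa = x , trans (cong (_% b) (trans (ℕₚ.*-comm a x) (sym 1+yb≡xa)))
        (ℕ/.[m+kn]%n≡m%n 1 y b)
-- Here x a ≡ -1 modulo b, and b′ = b - 1 also represents -1, so x b′ is an inverse of a.
... | Bézout.-+ x y 1+xa≡yb = x ℕ.* b′ , (begin
  (a ℕ.* (x ℕ.* b′)) % b             ≡⟨ ℕ/.[m+n]%n≡m%n (a ℕ.* (x ℕ.* b′)) b ⟨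
  (a ℕ.* (x ℕ.* b′) ℕ.+ b) % b       ≡⟨ cong (_% b) eq ⟩
  (1 ℕ.+ (b′ ℕ.* y) ℕ.* b) % b       ≡⟨ ℕ/.[m+kn]%n≡m%n 1 (b′ ℕ.* y) b ⟩
  1 % b ∎)
  where
  open ≡-Reasoning
  eq : a ℕ.* (x ℕ.* b′) ℕ.+ suc b′ ≡ 1 ℕ.+ (b′ ℕ.* y) ℕ.* b
  eq = begin
    a ℕ.* (x ℕ.* b′) ℕ.+ suc b′     ≡⟨ solve-ℕ 3 (λ a x b → a ∗ (x ∗ b) ⊹ (lit 1 ⊹ b) ≔ lit 1 ⊹ b ∗ (lit 1 ⊹ x ∗ a)) refl a x b′ ⟩
    1 ℕ.+ b′ ℕ.* (1 ℕ.+ x ℕ.* a)    ≡⟨ cong (λ z → 1 ℕ.+ b′ ℕ.* z) 1+xa≡yb ⟩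
    1 ℕ.+ b′ ℕ.* (y ℕ.* b)          ≡⟨ cong suc (sym (ℕₚ.*-assoc b′ y b)) ⟩
    1 ℕ.+ (b′ ℕ.* y) ℕ.* b ∎

-- Multiplication by an inverse of a modulo b undoes multiplication by a.
residue-permutation : ∀ a b .{{_ : NonZero b}} → Coprime a b → (f : ℕ → ℚ) →
  Σ< b (λ j → f ((a ℕ.* j) % b)) ≡ Σ< b f
residue-permutation a b coprime f with modular-inverse a b coprime
... | a⁻¹ , aa⁻¹≡1 = Σ<-permute b (λ j → (a ℕ.* j) % b) (λ j → (a⁻¹ ℕ.* j) % b)
    (λ j → ℕ/.m%n<n (a ℕ.* j) b) (λ j → ℕ/.m%n<n (a⁻¹ ℕ.* j) b)
    (inverse a a⁻¹ aa⁻¹≡1) (inverse a⁻¹ a (trans (cong (_% b) (ℕₚ.*-comm a⁻¹ a)) aa⁻¹≡1)) f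
  where
  open ≡-Reasoning
  inverse : ∀ m n → (m ℕ.* n) % b ≡ 1 % b → ∀ j → j < b → (m ℕ.* ((n ℕ.* j) % b)) % b ≡ j
  inverse m n mn≡1 j j<b = begin
    (m ℕ.* ((n ℕ.* j) % b)) % b         ≡⟨ %-*ʳ m (n ℕ.* j) b ⟩
    (m ℕ.* (n ℕ.* j)) % b               ≡⟨ cong (_% b) (trans (sym (ℕₚ.*-assoc m n j)) (ℕₚ.*-comm (m ℕ.* n) j)) ⟩
    (j ℕ.* (m ℕ.* n)) % b               ≡⟨ %-*ʳ j (m ℕ.* n) b ⟨
    (j ℕ.* ((m ℕ.* n) % b)) % b         ≡⟨ cong (λ z → (j ℕ.* z) % b) mn≡1 ⟩
    (j ℕ.* (1 % b)) % b                 ≡⟨ %-*ʳ j 1 b ⟩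
    (j ℕ.* 1) % b                       ≡⟨ cong (_% b) (ℕₚ.*-identityʳ j) ⟩
    j % b                               ≡⟨ ℕ/.m<n⇒m%n≡m j<b ⟩
    j ∎

-- The residues run over 0, ..., b - 1, so the sum is U_b (1 + w + ... + w^{b-1}) = ½ U_b U₁ (1 -
-- w^b), and U_b (1 - w^b) = 2.
U-residues : ∀ a b .{{_ : NonZero b}} → b % 2 ≡ 1 → Coprime a b →
  ∑ b (λ j → U b ⊛ w ((a ℕ.* j) % b)) ≈ u
U-residues a b odd coprime = ≈-trans (∑-⊛ˡ b (U b) (λ j → w ((a ℕ.* j) % b)))
  (≈-trans (⊛-cong {U b} ≈-refl (pointwise λ p → trans (residue-permutation a b coprime (λ r → w r p))
      (Σ<-cong b λ r _ → cong (λ z → w z p) (sym (ℕₚ.*-identityˡ r)))))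
  (≈-trans (⊛-cong {U b} ≈-refl (geometric-U 1 b refl))
  (≈-trans (solveR 3 (λ x y z → x ⊠ (K ½ ⊠ (y ⊠ z)) ≋ K ½ ⊠ y ⊠ (x ⊠ z)) ≈-refl (U b) (U 1) (one ⊕ ⊖ w (1 ℕ.* b)))
  (≈-trans (⊛-cong {κ ½ ⊛ U 1} ≈-refl (≈-trans
      (pointwise λ p → cong (λ z → (U b ⊛ (one ⊕ ⊖ w z)) p) (ℕₚ.*-identityˡ b)) (U-gf b odd)))
  (≈-trans (solveR 1 (λ x → K ½ ⊠ x ⊠ K 2ℚ ≋ x) ≈-refl (U 1))
    (pointwise λ p → trans (cong (_* u p) (1^ p)) (ℚₚ.*-identityˡ (u p))))))))

-- The reciprocity law

-- In a (2j - b) w^{aj} the part 2 a j w^{aj} is twice the derivative of w^{aj}, and the factor -ab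
-- of the other part is independent of j.
weighted-geometric : ∀ a b n →
  ∑ n (λ j → (ℕ→ℚ a * (ℕ→ℚ 2 * ℕ→ℚ j - ℕ→ℚ b)) · w (a ℕ.* j))
    ≈ κ 2ℚ ⊛ δ (∑ n (λ j → w (a ℕ.* j))) ⊕ κ (- (ℕ→ℚ a * ℕ→ℚ b)) ⊛ ∑ n (λ j → w (a ℕ.* j))
weighted-geometric a b n = ≈-trans (∑-cong n (λ j _ → step j))
  (≈-trans (∑-⊕ n (λ j → κ 2ℚ ⊛ δ (w (a ℕ.* j))) (λ j → κ (- (ℕ→ℚ a * ℕ→ℚ b)) ⊛ w (a ℕ.* j)))
    (⊕-cong (∑-⊛ˡ n (κ 2ℚ) (λ j → δ (w (a ℕ.* j))))
            (∑-⊛ˡ n (κ (- (ℕ→ℚ a * ℕ→ℚ b))) (λ j → w (a ℕ.* j)))))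
  where
  open ≡-Reasoning
  step : ∀ j → (ℕ→ℚ a * (ℕ→ℚ 2 * ℕ→ℚ j - ℕ→ℚ b)) · w (a ℕ.* j)
                 ≈ κ 2ℚ ⊛ δ (w (a ℕ.* j)) ⊕ κ (- (ℕ→ℚ a * ℕ→ℚ b)) ⊛ w (a ℕ.* j)
  step j .at p = begin
    ℕ→ℚ a * (ℕ→ℚ 2 * ℕ→ℚ j - ℕ→ℚ b) * w (a ℕ.* j) p
      ≡⟨ solve 4 (λ a j b z → a :* (con (ℕ→ℚ 2) :* j :- b) :* z := con 2ℚ :* (a :* j :* z) :+ (:- (a :* b)) :* z) refl
           (ℕ→ℚ a) (ℕ→ℚ j) (ℕ→ℚ b) (w (a ℕ.* j) p) ⟩
    2ℚ * (ℕ→ℚ a * ℕ→ℚ j * w (a ℕ.* j) p) + - (ℕ→ℚ a * ℕ→ℚ b) * w (a ℕ.* j) p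
      ≡⟨ cong₂ _+_ (cong (2ℚ *_) (trans (at (δ-w (a ℕ.* j)) p) (cong (_* w (a ℕ.* j) p) (ℕ→ℚ-* a j)))) refl ⟨
    2ℚ * δ (w (a ℕ.* j)) p + - (ℕ→ℚ a * ℕ→ℚ b) * w (a ℕ.* j) p
      ≡⟨ cong₂ _+_ (at (κ-⊛ 2ℚ (δ (w (a ℕ.* j)))) p) (at (κ-⊛ (- (ℕ→ℚ a * ℕ→ℚ b)) (w (a ℕ.* j))) p) ⟨
    (κ 2ℚ ⊛ δ (w (a ℕ.* j)) ⊕ κ (- (ℕ→ℚ a * ℕ→ℚ b)) ⊛ w (a ℕ.* j)) p ∎

module _ (a′ b′ : ℕ) (odda : suc a′ % 2 ≡ 1) (oddb : suc b′ % 2 ≡ 1) (coprime : Coprime (suc a′) (suc b′)) where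
  private
    a b : ℕ
    a = suc a′
    b = suc b′
    A B : ℚ
    A = ℕ→ℚ a
    B = ℕ→ℚ b
    weight : ℕ → ℕ → ℕ → ℚ
    weight x y j = ℕ→ℚ x * (ℕ→ℚ 2 * ℕ→ℚ j - ℕ→ℚ y)
    k : Series
    k = κ (- (A * B))
    -- `P` and `Q` are the geometric sums that multiply U_b and U_a, and `gap` is the lattice point
    -- sum g. `X` and `Y` carry the weights of the two halves; `Y` runs over the points on the other
    -- side of the line aj = mb.
    P Q gap X Y V : Series
    P = ∑ b (λ j → w (a ℕ.* j))
    Q = ∑ a (λ m → w (b ℕ.* m))
    gap = ∑ b′ (λ j → ∑ a′ (λ m → χ (a ℕ.* suc j) (suc m ℕ.* b)))
    X = ∑ b′ (λ j → ∑ a′ (λ m → weight a b (suc j) · χ (a ℕ.* suc j) (suc m ℕ.* b)))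
    Y = ∑ a′ (λ m → ∑ b′ (λ j → weight b a (suc m) · χ (b ℕ.* suc m) (suc j ℕ.* a)))
    V = one ⊕ ⊖ w (a ℕ.* b)

    -- The substitution (j , m) ↦ (b - j , a - m) carries the lattice points of Y to those of X.
    Y-reflect : ∀ p → Y p ≡ Σ< b′ (λ j → Σ< a′ (λ m → - weight b a (suc m) * χ (a ℕ.* suc j) (suc m ℕ.* b) p))
    Y-reflect p = begin
      Σ< a′ (λ m → Σ< b′ (λ j → F m j))
        ≡⟨ Σ<-swap a′ b′ F ⟩
      Σ< b′ (λ j → Σ< a′ (λ m → F m j))
        -- An index j stands for the coordinate j + 1, so reversing the range replaces j + 1 by b -
        -- (j + 1).
        ≡⟨ Σ<-reverse b′ (λ j → Σ< a′ (λ m → F m j)) ⟩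
      Σ< b′ (λ j → Σ< a′ (λ m → F m (b′ ∸ suc j)))
        ≡⟨ Σ<-cong b′ (λ j j<b′ → trans (Σ<-reverse a′ (λ m → F m (b′ ∸ suc j)))
             (Σ<-cong a′ (λ m m<a′ → cong₂ _*_ (weight-reflect m m<a′) (cong (λ f → f p) (χ-flip j m j<b′ m<a′))))) ⟩
      Σ< b′ (λ j → Σ< a′ (λ m → - weight b a (suc m) * χ (a ℕ.* suc j) (suc m ℕ.* b) p)) ∎
      where
      open ≡-Reasoning
      F : ℕ → ℕ → ℚ
      F m j = weight b a (suc m) * χ (b ℕ.* suc m) (suc j ℕ.* a) p
      suc-∸ : ∀ {i n} → i < n → suc (n ∸ suc i) ≡ n ∸ i
      suc-∸ i<n = sym (ℕₚ.+-∸-assoc 1 i<n)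
      weight-reflect : ∀ m → m < a′ → weight b a (suc (a′ ∸ suc m)) ≡ - weight b a (suc m)
      weight-reflect m m<a′ = begin
        weight b a n                          ≡⟨ cong (λ z → B * (ℕ→ℚ 2 * ℕ→ℚ n - z)) A≡ ⟩
        B * (ℕ→ℚ 2 * ℕ→ℚ n - (ℕ→ℚ n + ℕ→ℚ (suc m)))
          ≡⟨ solve 3 (λ b n m → b :* (con (ℕ→ℚ 2) :* n :- (n :+ m)) := :- (b :* (con (ℕ→ℚ 2) :* m :- (n :+ m)))) refl B (ℕ→ℚ n) (ℕ→ℚ (suc m)) ⟩
        - (B * (ℕ→ℚ 2 * ℕ→ℚ (suc m) - (ℕ→ℚ n + ℕ→ℚ (suc m))))
          ≡⟨ cong (λ z → - (B * (ℕ→ℚ 2 * ℕ→ℚ (suc m) - z))) A≡ ⟨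
        - weight b a (suc m) ∎
        where
        n = suc (a′ ∸ suc m)
        A≡ : A ≡ ℕ→ℚ n + ℕ→ℚ (suc m)
        A≡ = trans (cong ℕ→ℚ (cong suc (sym (ℕₚ.m∸n+n≡m m<a′)))) (ℕ→ℚ-+ n (suc m))
      χ-flip : ∀ j m → j < b′ → m < a′ →
        χ (b ℕ.* suc (a′ ∸ suc m)) (suc (b′ ∸ suc j) ℕ.* a) ≡ χ (a ℕ.* suc j) (suc m ℕ.* b)
      χ-flip j m j<b′ m<a′ = begin
        χ (b ℕ.* suc (a′ ∸ suc m)) (suc (b′ ∸ suc j) ℕ.* a)
          ≡⟨ cong₂ (λ x y → χ (b ℕ.* x) (y ℕ.* a)) (suc-∸ m<a′) (suc-∸ j<b′) ⟩
        χ (b ℕ.* (a ∸ suc m)) ((b ∸ suc j) ℕ.* a)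
          ≡⟨ cong₂ χ (ℕₚ.*-distribˡ-∸ b a (suc m)) (ℕₚ.*-distribʳ-∸ a b (suc j)) ⟩
        χ (b ℕ.* a ∸ b ℕ.* suc m) (b ℕ.* a ∸ suc j ℕ.* a)
          -- Both arguments are reflected in a b: in coordinates, b (a - m) - (b - j) a = j a - b m.
          ≡⟨ χ-reflect (b ℕ.* a) (suc j ℕ.* a) (b ℕ.* suc m)
               (ℕₚ.*-monoˡ-≤ a (ℕₚ.m≤n⇒m≤1+n j<b′)) (ℕₚ.*-monoʳ-≤ b (ℕₚ.m≤n⇒m≤1+n m<a′)) ⟩
        χ (suc j ℕ.* a) (b ℕ.* suc m)
          ≡⟨ cong₂ χ (ℕₚ.*-comm (suc j) a) (ℕₚ.*-comm b (suc m)) ⟩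
        χ (a ℕ.* suc j) (suc m ℕ.* b) ∎

    -- The weights a (2j - b) and -b (2m - a) add up to 2 (aj - mb), twice the exponent at the point
    -- (j, m), so each term becomes twice a derivative.
    X⊕Y : X ⊕ Y ≈ κ 2ℚ ⊛ δ gap
    X⊕Y .at p = begin
      X p + Y p
        ≡⟨ cong (X p +_) (Y-reflect p) ⟩
      X p + Σ< b′ (λ j → Σ< a′ (λ m → - weight b a (suc m) * G j m p))
        ≡⟨ Σ<-+ b′ (λ j → Σ< a′ (λ m → weight a b (suc j) * G j m p)) (λ j → Σ< a′ (λ m → - weight b a (suc m) * G j m p)) ⟨
      Σ< b′ (λ j → Σ< a′ (λ m → weight a b (suc j) * G j m p) + Σ< a′ (λ m → - weight b a (suc m) * G j m p))
        ≡⟨ Σ<-cong b′ (λ j _ → trans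
             (sym (Σ<-+ a′ (λ m → weight a b (suc j) * G j m p) (λ m → - weight b a (suc m) * G j m p)))
             (trans (Σ<-cong a′ (λ m _ → step j m)) (Σ<-*ˡ a′ 2ℚ (λ m → δ (G j m) p)))) ⟩
      Σ< b′ (λ j → 2ℚ * Σ< a′ (λ m → δ (G j m) p))
        ≡⟨ Σ<-*ˡ b′ 2ℚ (λ j → Σ< a′ (λ m → δ (G j m) p)) ⟩
      2ℚ * δ gap p
        ≡⟨ at (κ-⊛ 2ℚ (δ gap)) p ⟨
      (κ 2ℚ ⊛ δ gap) p ∎
      where
      open ≡-Reasoning
      G : ℕ → ℕ → Series
      G j m = χ (a ℕ.* suc j) (suc m ℕ.* b)
      step : ∀ j m → weight a b (suc j) * G j m p + - weight b a (suc m) * G j m p ≡ 2ℚ * δ (G j m) p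
      step j m = begin
        weight a b (suc j) * G j m p + - weight b a (suc m) * G j m p
          ≡⟨ solve 5 (λ a b j m g → a :* (con (ℕ→ℚ 2) :* j :- b) :* g :+ (:- (b :* (con (ℕ→ℚ 2) :* m :- a))) :* g
                                      := con 2ℚ :* ((a :* j :- m :* b) :* g)) refl
               A B (ℕ→ℚ (suc j)) (ℕ→ℚ (suc m)) (G j m p) ⟩
        2ℚ * ((A * ℕ→ℚ (suc j) - ℕ→ℚ (suc m) * B) * G j m p)
          ≡⟨ cong₂ (λ x y → 2ℚ * ((x - y) * G j m p)) (ℕ→ℚ-* a (suc j)) (ℕ→ℚ-* (suc m) b) ⟨
        2ℚ * ((ℕ→ℚ (a ℕ.* suc j) - ℕ→ℚ (suc m ℕ.* b)) * G j m p)
          ≡⟨ cong (2ℚ *_) (at (δ-χ (a ℕ.* suc j) (suc m ℕ.* b)) p) ⟨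
        2ℚ * δ (G j m) p ∎

    -- The unweighted residue sum is evaluated twice: by permuting the residues, and by
    -- `residue-sum` with all weights 1.
    u-gap : u ≈ U b ⊛ P ⊕ κ 2ℚ ⊛ gap
    u-gap = ≈-trans (≈-sym (U-residues a b oddb coprime))
      (≈-trans (∑-cong b (λ j _ → ≈-sym (1· (U b ⊛ w ((a ℕ.* j) % b)))))
      (≈-trans (residue-sum a′ b′ oddb (λ _ → 1ℚ))
        (⊕-cong (⊛-cong {U b} ≈-refl (∑-cong b λ j _ → 1· (w (a ℕ.* j))))
          (⊛-cong {κ 2ℚ} ≈-refl (∑-cong b′ λ j _ → ∑-cong a′ λ m _ → 1· (χ (a ℕ.* suc j) (suc m ℕ.* b)))))))
      where
      1· : ∀ f → 1ℚ · f ≈ f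
      1· f .at n = ℚₚ.*-identityˡ (f n)

    -- The derivative of `u-gap`, solved for the lattice term.
    2δgap : κ 2ℚ ⊛ δ gap ≈ δ u ⊕ ⊖ (δ (U b) ⊛ P ⊕ U b ⊛ δ P)
    2δgap = ≈-trans
      (solveR 2 (λ x y → x ≋ (y ⊞ x) ⊞ ⊟ y) ≈-refl (κ 2ℚ ⊛ δ gap) (δ (U b) ⊛ P ⊕ U b ⊛ δ P))
      (⊕-cong (≈-sym (≈-trans (δ-cong u-gap) (⊕-cong {δ (U b) ⊛ P ⊕ U b ⊛ δ P} (pointwise λ _ → refl) (κ-δ 2ℚ gap)))) ≈-refl)

    P-closed : P ≈ κ ½ ⊛ (U a ⊛ V)
    P-closed = geometric-U a b odda

    Q-closed : Q ≈ κ ½ ⊛ (U b ⊛ V)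
    Q-closed = ≈-trans (geometric-U b a oddb)
      (pointwise λ p → cong (λ n → (κ ½ ⊛ (U b ⊛ (one ⊕ ⊖ w n))) p) (ℕₚ.*-comm b a))

    δV : δ V ≈ k ⊛ w (a ℕ.* b)
    δV .at p = begin
      0ℚ + - δ (w (a ℕ.* b)) p          ≡⟨ cong (λ z → 0ℚ + - z) (trans (at (δ-w (a ℕ.* b)) p) (cong (_* w (a ℕ.* b) p) (ℕ→ℚ-* a b))) ⟩
      0ℚ + - (A * B * w (a ℕ.* b) p)    ≡⟨ solve 2 (λ x y → con 0ℚ :+ :- (x :* y) := (:- x) :* y) refl (A * B) (w (a ℕ.* b) p) ⟩
      - (A * B) * w (a ℕ.* b) p         ≡⟨ at (κ-⊛ (- (A * B)) (w (a ℕ.* b))) p ⟨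
      (k ⊛ w (a ℕ.* b)) p ∎
      where open ≡-Reasoning

    δQ-closed : δ Q ≈ κ ½ ⊛ (δ (U b) ⊛ V ⊕ U b ⊛ (k ⊛ w (a ℕ.* b)))
    δQ-closed = ≈-trans (δ-cong Q-closed) (≈-trans (κ-δ ½ (U b ⊛ V))
      (⊛-cong {κ ½} ≈-refl (⊕-cong {δ (U b) ⊛ V} ≈-refl (⊛-cong {U b} ≈-refl δV))))

    half : ∀ x y .{{_ : NonZero y}} → ℕ→ℚ x · ∑ y (term x y) ≈ ∑ y (λ j → weight x y j · (U y ⊛ w ((x ℕ.* j) % y)))
    half x y = ≈-trans (≈-sym (·-∑ y (ℕ→ℚ x) (term x y)))
      (∑-cong y λ j _ → pointwise λ p → sym (ℚₚ.*-assoc (ℕ→ℚ x) (ℕ→ℚ 2 * ℕ→ℚ j - ℕ→ℚ y) ((U y ⊛ w ((x ℕ.* j) % y)) p)))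

  -- `residue-sum` expands the two halves into geometric sums and 2 (X + Y). By `X⊕Y` and `2δgap`
  -- the lattice part is expressed through `u`, `U b`, `P` and their derivatives; then the closed
  -- forms of `P`, `Q` and `δ Q` are inserted.
  reciprocity-series : A · ∑ b (term a b) ⊕ B · ∑ a (term b a) ≈ κ 2ℚ ⊛ δ u ⊕ k ⊛ (U b ⊛ U a)
  reciprocity-series = ≈-trans (⊕-cong
      (≈-trans (half a b) (≈-trans (residue-sum a′ b′ oddb (weight a b))
        (⊕-cong {g = κ 2ℚ ⊛ X} (⊛-cong {U b} ≈-refl (≈-trans (weighted-geometric a b b)
          (⊕-cong {κ 2ℚ ⊛ δ P} ≈-refl (⊛-cong {k} ≈-refl P-closed)))) ≈-refl)))
      (≈-trans (half b a) (≈-trans (residue-sum b′ a′ odda (weight b a))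
        (⊕-cong {g = κ 2ℚ ⊛ Y} (⊛-cong {U a} ≈-refl (≈-trans (weighted-geometric b a a)
          (⊕-cong (⊛-cong {κ 2ℚ} ≈-refl δQ-closed)
            (⊛-cong (pointwise λ p → cong (λ z → κ (- z) p) (ℚₚ.*-comm B A)) Q-closed)))) ≈-refl))))
    (≈-trans (solveR 4 (λ x y p q → (p ⊞ K 2ℚ ⊠ x) ⊞ (q ⊞ K 2ℚ ⊠ y) ≋ p ⊞ q ⊞ K 2ℚ ⊠ (x ⊞ y)) ≈-refl X Y L M)
    (≈-trans (⊕-cong {L ⊕ M} ≈-refl (⊛-cong {κ 2ℚ} ≈-refl (≈-trans X⊕Y (≈-trans 2δgap
        (⊕-cong {δ u} ≈-refl (pointwise λ p → cong -_ (at (⊕-cong {g = U b ⊛ δ P} (⊛-cong {δ (U b)} ≈-refl P-closed) ≈-refl) p)))))))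
      -- `δ P` and `δ (U b)` are treated as unknowns and cancel: each occurs twice with opposite
      -- signs, the latter times U_a (1 - w^{ab}). The terms in k U_a U_b have total coefficient (1
      -- - w^{ab}) + w^{ab} = 1.
      (solveR 7 (λ ua ub ub′ p′ k v u′ →
          ub ⊠ (K 2ℚ ⊠ p′ ⊞ k ⊠ (K ½ ⊠ (ua ⊠ (K 1ℚ ⊞ ⊟ v))))
          ⊞ ua ⊠ (K 2ℚ ⊠ (K ½ ⊠ (ub′ ⊠ (K 1ℚ ⊞ ⊟ v) ⊞ ub ⊠ (k ⊠ v))) ⊞ k ⊠ (K ½ ⊠ (ub ⊠ (K 1ℚ ⊞ ⊟ v))))
          ⊞ K 2ℚ ⊠ (u′ ⊞ ⊟ (ub′ ⊠ (K ½ ⊠ (ua ⊠ (K 1ℚ ⊞ ⊟ v))) ⊞ ub ⊠ p′))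
          ≋ K 2ℚ ⊠ u′ ⊞ k ⊠ (ub ⊠ ua)) ≈-refl
        (U a) (U b) (δ (U b)) (δ P) k (w (a ℕ.* b)) (δ u))))
    where
    L M : Series
    L = U b ⊛ (κ 2ℚ ⊛ δ P ⊕ k ⊛ (κ ½ ⊛ (U a ⊛ V)))
    M = U a ⊛ (κ 2ℚ ⊛ (κ ½ ⊛ (δ (U b) ⊛ V ⊕ U b ⊛ (k ⊛ w (a ℕ.* b)))) ⊕ k ⊛ (κ ½ ⊛ (U b ⊛ V)))

-- The reflection t ↦ -t and the case of odd p

U-reflect : ∀ b → b % 2 ≡ 1 → dilate (- 1ℚ) (U b) ≈ ⊖ (U b ⊛ w b)
U-reflect b odd = ≈-trans (pointwise λ p →
    solve 3 (λ x y z → x :* (y :* z) := y :* (x :* z)) refl ((- 1ℚ) ^ℚ p) (ℕ→ℚ b ^ℚ p) (u p))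
  (≈-trans (dilate-cong (ℕ→ℚ b) u-reflect)
  (≈-trans (dilate-⊛ (ℕ→ℚ b) u (exp 1ℚ))
  (≈-trans (⊛-cong {U b} ≈-refl (≈-trans (dilate-exp (ℕ→ℚ b) 1ℚ)
      (≈-trans (pointwise λ p → cong (_^ℚ p) (ℚₚ.*-identityʳ (ℕ→ℚ b))) (exp≈w b odd))))
    (solveR 2 (λ x y → x ⊠ ⊟ y ≋ ⊟ (x ⊠ y)) ≈-refl (U b) (w b)))))

w-reflect : ∀ r → dilate (- 1ℚ) (w r) ⊛ w r ≈ one
w-reflect r = ≈-trans (⊛-cong (≈-trans
    (pointwise λ p → solve 3 (λ x y z → x :* (y :* z) := y :* (x :* z)) refl (sgn p) (sgn r) (exp (ℕ→ℚ r) p))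
    (·-cong (sgn r) (dilate-exp (- 1ℚ) (ℕ→ℚ r)))) ≈-refl)
  (≈-trans (·-⊛ (sgn r) (exp (- 1ℚ * ℕ→ℚ r)) (w r))
  (≈-trans (·-cong (sgn r) (·-⊛ʳ (sgn r) (exp (- 1ℚ * ℕ→ℚ r)) (exp (ℕ→ℚ r))))
  (≈-trans (pointwise λ p → sym (ℚₚ.*-assoc (sgn r) (sgn r) ((exp (- 1ℚ * ℕ→ℚ r) ⊛ exp (ℕ→ℚ r)) p)))
  (≈-trans (pointwise λ p → trans (cong (_* (exp (- 1ℚ * ℕ→ℚ r) ⊛ exp (ℕ→ℚ r)) p) (sgn² r)) (ℚₚ.*-identityˡ _))
  (≈-trans (exp-⊛ (- 1ℚ * ℕ→ℚ r) (ℕ→ℚ r))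
  (≈-trans (pointwise λ p → cong (_^ℚ p) (solve 1 (λ x → con (- 1ℚ) :* x :+ x := con 0ℚ) refl (ℕ→ℚ r))) exp0))))))

-- Under t ↦ -t, U_b becomes -U_b w^b and w^r becomes its inverse. This is the symmetry E_p(1 - y) =
-- (-1)^p E_p(y) at y = r/b, in terms of generating functions.
U⊛w-reflect : ∀ b r → b % 2 ≡ 1 → r ≤ b → dilate (- 1ℚ) (U b ⊛ w r) ≈ ⊖ (U b ⊛ w (b ∸ r))
U⊛w-reflect b r odd r≤b = ≈-trans (dilate-⊛ (- 1ℚ) (U b) (w r))
  (≈-trans (⊛-cong {g = dilate (- 1ℚ) (w r)} (≈-trans (U-reflect b odd)
      (pointwise λ p → cong -_ (at (⊛-cong {U b} ≈-refl
        (≈-trans (pointwise λ q → cong (λ z → w z q) (sym (ℕₚ.m∸n+n≡m r≤b))) (≈-sym (w-⊛ (b ∸ r) r)))) p))) ≈-refl)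
  (≈-trans (solveR 4 (λ u x y z → ⊟ (u ⊠ (x ⊠ y)) ⊠ z ≋ ⊟ (u ⊠ x) ⊠ (z ⊠ y)) ≈-refl (U b) (w (b ∸ r)) (w r) (dilate (- 1ℚ) (w r)))
  (≈-trans (⊛-cong {⊖ (U b ⊛ w (b ∸ r))} ≈-refl (w-reflect r))
    (solveR 1 (λ x → x ⊠ K 1ℚ ≋ x) ≈-refl (⊖ (U b ⊛ w (b ∸ r)))))))

-- The residues of a (b - j) and a j add up to a multiple of b below 2b. It is not 0, because b does
-- not divide a j when 0 < j < b and a, b are coprime.
residue-complement : ∀ a b j .{{_ : NonZero b}} .{{_ : NonZero j}} → Coprime a b → j < b →
  (a ℕ.* (b ∸ j)) % b ≡ b ∸ (a ℕ.* j) % b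
residue-complement a b j coprime j<b = sym (trans (cong (_∸ r) (sym s+r≡b)) (ℕₚ.m+n∸n≡m s r))
  where
  open ≡-Reasoning
  r s : ℕ
  r = (a ℕ.* j) % b
  s = (a ℕ.* (b ∸ j)) % b
  r≢0 : ¬ (r ≡ 0)
  r≢0 r≡0 = ℕₚ.<⇒≱ j<b (∣⇒≤ (Coprimality.coprime-divisor (Coprimality.sym coprime) (m%n≡0⇒n∣m (a ℕ.* j) b r≡0)))
  [s+r]%b : (s ℕ.+ r) % b ≡ 0
  [s+r]%b = begin
    (s ℕ.+ r) % b                                ≡⟨ ℕ/.%-distribˡ-+ (a ℕ.* (b ∸ j)) (a ℕ.* j) b ⟨
    (a ℕ.* (b ∸ j) ℕ.+ a ℕ.* j) % b              ≡⟨ cong (_% b) (sym (ℕₚ.*-distribˡ-+ a (b ∸ j) j)) ⟩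
    (a ℕ.* (b ∸ j ℕ.+ j)) % b                    ≡⟨ cong (λ z → (a ℕ.* z) % b) (ℕₚ.m∸n+n≡m (ℕₚ.<⇒≤ j<b)) ⟩
    (a ℕ.* b) % b                                ≡⟨ ℕ/.m*n%n≡0 a b ⟩
    0 ∎
  s+r≡b : s ℕ.+ r ≡ b
  s+r≡b with m%n≡0⇒n∣m (s ℕ.+ r) b [s+r]%b
  ... | divides 0 eq = contradiction (ℕₚ.m+n≡0⇒n≡0 s eq) r≢0
  ... | divides 1 eq = trans eq (ℕₚ.+-identityʳ b)
  ... | divides (suc (suc q)) eq = contradiction
          (ℕₚ.+-mono-< (ℕ/.m%n<n (a ℕ.* (b ∸ j)) b) (ℕ/.m%n<n (a ℕ.* j) b))
          (ℕₚ.≤⇒≯ (subst (b ℕ.+ b ≤_) (sym eq) (ℕₚ.+-monoʳ-≤ b (ℕₚ.m≤m+n b (q ℕ.* b)))))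

-- The terms at j and b - j cancel: 2j - b changes sign, while for odd `p` the p-th coefficient of
-- `U b ⊛ w r` is the same at r and b - r. Only j = 0 is left, with weight -b.
term-sum-odd : ∀ a b .{{_ : NonZero b}} → b % 2 ≡ 1 → Coprime a b → ∀ p → p % 2 ≡ 1 →
  ∑ b (term a b) p ≡ - (ℕ→ℚ b * (ℕ→ℚ b ^ℚ p * E p 0ℚ))
term-sum-odd a b@(suc b′) oddb coprime p oddp = begin
  ∑ b (term a b) p                          ≡⟨ Σ<-suc b′ F ⟩
  F 0 + Σ< b′ (F ∘ suc)                     ≡⟨ cong₂ _+_ F0 (double-zero (Σ< b′ (F ∘ suc)) pairs) ⟩
  - (ℕ→ℚ b * (ℕ→ℚ b ^ℚ p * E p 0ℚ)) + 0ℚ    ≡⟨ ℚₚ.+-identityʳ _ ⟩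
  - (ℕ→ℚ b * (ℕ→ℚ b ^ℚ p * E p 0ℚ)) ∎
  where
  open ≡-Reasoning
  F : ℕ → ℚ
  F j = term a b j p
  F0 : F 0 ≡ - (ℕ→ℚ b * (ℕ→ℚ b ^ℚ p * E p 0ℚ))
  F0 = begin
    (ℕ→ℚ 2 * ℕ→ℚ 0 - ℕ→ℚ b) * (U b ⊛ w ((a ℕ.* 0) % b)) p
      ≡⟨ cong (λ z → (ℕ→ℚ 2 * ℕ→ℚ 0 - ℕ→ℚ b) * (U b ⊛ w (z % b)) p) (ℕₚ.*-zeroʳ a) ⟩
    (ℕ→ℚ 2 * ℕ→ℚ 0 - ℕ→ℚ b) * (U b ⊛ w 0) p
      ≡⟨ cong ((ℕ→ℚ 2 * ℕ→ℚ 0 - ℕ→ℚ b) *_) (at (≈-trans (⊛-cong {U b} ≈-refl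
           (≈-trans (pointwise λ q → ℚₚ.*-identityˡ (exp 0ℚ q)) exp0))
           (solveR 1 (λ x → x ⊠ K 1ℚ ≋ x) ≈-refl (U b))) p) ⟩
    (ℕ→ℚ 2 * ℕ→ℚ 0 - ℕ→ℚ b) * U b p
      ≡⟨ solve 2 (λ b x → (con (ℕ→ℚ 2) :* con (ℕ→ℚ 0) :- b) :* x := :- (b :* x)) refl (ℕ→ℚ b) (U b p) ⟩
    - (ℕ→ℚ b * U b p) ∎
  negate : ∀ i → i < b′ → F (suc (b′ ∸ suc i)) ≡ - 1ℚ * F (suc i)
  negate i i<b′ = begin
    F n
      ≡⟨ cong (λ z → (ℕ→ℚ 2 * ℕ→ℚ n - z) * (U b ⊛ w ((a ℕ.* n) % b)) p) B≡ ⟩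
    (ℕ→ℚ 2 * ℕ→ℚ n - (ℕ→ℚ n + ℕ→ℚ (suc i))) * (U b ⊛ w ((a ℕ.* n) % b)) p
      ≡⟨ cong ((ℕ→ℚ 2 * ℕ→ℚ n - (ℕ→ℚ n + ℕ→ℚ (suc i))) *_) reflected ⟩
    (ℕ→ℚ 2 * ℕ→ℚ n - (ℕ→ℚ n + ℕ→ℚ (suc i))) * y
      ≡⟨ solve 3 (λ n i y → (con (ℕ→ℚ 2) :* n :- (n :+ i)) :* y := con (- 1ℚ) :* ((con (ℕ→ℚ 2) :* i :- (n :+ i)) :* y)) refl
           (ℕ→ℚ n) (ℕ→ℚ (suc i)) y ⟩
    - 1ℚ * ((ℕ→ℚ 2 * ℕ→ℚ (suc i) - (ℕ→ℚ n + ℕ→ℚ (suc i))) * y)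
      ≡⟨ cong (λ z → - 1ℚ * ((ℕ→ℚ 2 * ℕ→ℚ (suc i) - z) * y)) B≡ ⟨
    - 1ℚ * F (suc i) ∎
    where
    n = suc (b′ ∸ suc i)
    r = (a ℕ.* suc i) % b
    y = (U b ⊛ w r) p
    B≡ : ℕ→ℚ b ≡ ℕ→ℚ n + ℕ→ℚ (suc i)
    B≡ = trans (cong ℕ→ℚ (cong suc (sym (ℕₚ.m∸n+n≡m i<b′)))) (ℕ→ℚ-+ n (suc i))
    reflected : (U b ⊛ w ((a ℕ.* n) % b)) p ≡ y
    reflected = begin
      (U b ⊛ w ((a ℕ.* n) % b)) p
        ≡⟨ cong (λ z → (U b ⊛ w z) p) (trans (cong (λ z → (a ℕ.* z) % b) (sym (ℕₚ.+-∸-assoc 1 i<b′)))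
             (residue-complement a b (suc i) coprime (s≤s i<b′))) ⟩
      (U b ⊛ w (b ∸ r)) p
        ≡⟨ solve 1 (λ x → x := :- :- x) refl ((U b ⊛ w (b ∸ r)) p) ⟩
      - - (U b ⊛ w (b ∸ r)) p
        ≡⟨ cong -_ (at (U⊛w-reflect b r oddb (ℕₚ.<⇒≤ (ℕ/.m%n<n (a ℕ.* suc i) b))) p) ⟨
      - (sgn p * y)
        ≡⟨ cong (λ s → - (s * y)) (sgn-odd p oddp) ⟩
      - (- 1ℚ * y)
        ≡⟨ solve 1 (λ y → :- (con (- 1ℚ) :* y) := y) refl y ⟩
      y ∎
  -- Reversal shows that the sum over j > 0 equals its own negative, which avoids splitting it into
  -- pairs.
  pairs : Σ< b′ (F ∘ suc) + Σ< b′ (F ∘ suc) ≡ 0ℚ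
  pairs = begin
    Σ< b′ (F ∘ suc) + Σ< b′ (F ∘ suc)
      ≡⟨ cong (Σ< b′ (F ∘ suc) +_) (trans (Σ<-reverse b′ (F ∘ suc)) (trans (Σ<-cong b′ negate) (Σ<-*ˡ b′ (- 1ℚ) (F ∘ suc)))) ⟩
    Σ< b′ (F ∘ suc) + - 1ℚ * Σ< b′ (F ∘ suc)
      ≡⟨ solve 1 (λ x → x :+ con (- 1ℚ) :* x := con 0ℚ) refl (Σ< b′ (F ∘ suc)) ⟩
    0ℚ ∎

-- `T-series` carries one factor b more than this identity; the rational 1/b removes it.
T-odd : ∀ a b .{{_ : NonZero b}} → a % 2 ≡ 1 → b % 2 ≡ 1 → Coprime a b → ∀ p → p % 2 ≡ 1 →
  ℕ→ℚ b ^ℚ p * T p a b ≡ - (ℕ→ℚ b ^ℚ p * E p 0ℚ)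
T-odd a b odda oddb coprime p oddp = begin
  x                                   ≡⟨ ℚₚ.*-identityˡ x ⟨
  1ℚ * x                              ≡⟨ cong (_* x) (/-*-cancel 1 b) ⟨
  b⁻¹ * ℕ→ℚ b * x                     ≡⟨ solve 4 (λ c b y t → c :* b :* (y :* t) := c :* (b :* y :* t)) refl b⁻¹ (ℕ→ℚ b) (ℕ→ℚ b ^ℚ p) (T p a b) ⟩
  b⁻¹ * (ℕ→ℚ b ^ℚ suc p * T p a b)    ≡⟨ cong (b⁻¹ *_) (trans (T-series a b odda oddb p) (term-sum-odd a b oddb coprime p oddp)) ⟩
  b⁻¹ * - (ℕ→ℚ b * y)                 ≡⟨ solve 3 (λ c b y → c :* :- (b :* y) := c :* b :* :- y) refl b⁻¹ (ℕ→ℚ b) y ⟩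
  b⁻¹ * ℕ→ℚ b * - y                   ≡⟨ cong (_* - y) (/-*-cancel 1 b) ⟩
  1ℚ * - y                            ≡⟨ ℚₚ.*-identityˡ (- y) ⟩
  - y ∎
  where
  open ≡-Reasoning
  b⁻¹ = (ℤ.+ 1) / b
  x = ℕ→ℚ b ^ℚ p * T p a b
  y = ℕ→ℚ b ^ℚ p * E p 0ℚ

-- The two identities

U⊛U-coeff : ∀ a b p → p % 2 ≡ 0 → NonZero p →
  (U b ⊛ U a) p ≡ Σ< p (λ k → ℕ→ℚ (p C k) * (ℕ→ℚ b ^ℚ k) * E k (ℕ→ℚ 0) * (ℕ→ℚ a ^ℚ (p ∸ k)) * E (p ∸ k) (ℕ→ℚ 0))
U⊛U-coeff a b p even p≢0 = trans (⊛-coeff p (U b) (U a)) (trans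
  (cong₂ _+_ (Σ<-cong p λ k _ → solve 5 (λ c x e y f → c :* (x :* e :* (y :* f)) := c :* x :* e :* y :* f) refl
      (ℕ→ℚ (p C k)) (ℕ→ℚ b ^ℚ k) (E k 0ℚ) (ℕ→ℚ a ^ℚ (p ∸ k)) (E (p ∸ k) 0ℚ))
    -- The term k = p of the product vanishes because E_p(0) = 0 for even positive p; hence the sum
    -- stops at p - 1.
    (trans (cong (λ e → ℕ→ℚ (p C p) * (ℕ→ℚ b ^ℚ p * e * U a (p ∸ p))) (E-even-zero p even p≢0))
      (solve 3 (λ c x y → c :* (x :* con 0ℚ :* y) := con 0ℚ) refl (ℕ→ℚ (p C p)) (ℕ→ℚ b ^ℚ p) (U a (p ∸ p)))))
  (ℚₚ.+-identityʳ _))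

theorem1p1 : (a b : ℕ) → .{{_ : NonZero a}} → .{{_ : NonZero b}} →
    a % 2 ≡ 1 → b % 2 ≡ 1 → gcd a b ≡ 1 →
    ((p : ℕ) → p % 2 ≡ 0 → NonZero p →
    ℕ→ℚ a * (ℕ→ℚ b ^ℚ suc p) * T p a b + (ℕ→ℚ a ^ℚ suc p) * ℕ→ℚ b * T p b a
    ≡ ℕ→ℚ 2 * E (suc p) (ℕ→ℚ 0)
    - ℕ→ℚ a * ℕ→ℚ b * Σ< p (λ k → ℕ→ℚ (p C k) * (ℕ→ℚ b ^ℚ k) * E k (ℕ→ℚ 0)
    * (ℕ→ℚ a ^ℚ (p ∸ k)) * E (p ∸ k) (ℕ→ℚ 0)))
    × ((p : ℕ) → p % 2 ≡ 1 →
    (ℕ→ℚ b ^ℚ p) * T p a b - (ℕ→ℚ a ^ℚ p) * T p b a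
    ≡ ((ℕ→ℚ a ^ℚ p) - (ℕ→ℚ b ^ℚ p)) * E p (ℕ→ℚ 0))
theorem1p1 a@(suc a′) b@(suc b′) odda oddb gcd≡1 = even-case , odd-case
  where
  open ≡-Reasoning
  coprime : Coprime a b
  coprime = Coprimality.gcd≡1⇒coprime gcd≡1
  A = ℕ→ℚ a
  B = ℕ→ℚ b
  even-case : (p : ℕ) → p % 2 ≡ 0 → NonZero p →
    A * (B ^ℚ suc p) * T p a b + (A ^ℚ suc p) * B * T p b a
    ≡ ℕ→ℚ 2 * E (suc p) (ℕ→ℚ 0)
      - A * B * Σ< p (λ k → ℕ→ℚ (p C k) * (B ^ℚ k) * E k (ℕ→ℚ 0) * (A ^ℚ (p ∸ k)) * E (p ∸ k) (ℕ→ℚ 0))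
  even-case p even p≢0 = begin
    A * B ^ℚ suc p * T p a b + A ^ℚ suc p * B * T p b a
      ≡⟨ solve 6 (λ a b x y s t → a :* x :* s :+ y :* b :* t := a :* (x :* s) :+ b :* (y :* t)) refl
           A B (B ^ℚ suc p) (A ^ℚ suc p) (T p a b) (T p b a) ⟩
    A * (B ^ℚ suc p * T p a b) + B * (A ^ℚ suc p * T p b a)
      ≡⟨ cong₂ (λ s t → A * s + B * t) (T-series a b odda oddb p) (T-series b a oddb odda p) ⟩
    A * ∑ b (term a b) p + B * ∑ a (term b a) p
      ≡⟨ at (reciprocity-series a′ b′ odda oddb coprime) p ⟩
    (κ 2ℚ ⊛ δ u) p + (κ (- (A * B)) ⊛ (U b ⊛ U a)) p
      ≡⟨ cong₂ _+_ (at (κ-⊛ 2ℚ (δ u)) p) (at (κ-⊛ (- (A * B)) (U b ⊛ U a)) p) ⟩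
    2ℚ * E (suc p) 0ℚ + - (A * B) * (U b ⊛ U a) p
      ≡⟨ cong (2ℚ * E (suc p) 0ℚ +_) (ℚₚ.neg-distribˡ-* (A * B) ((U b ⊛ U a) p)) ⟨
    2ℚ * E (suc p) 0ℚ - A * B * (U b ⊛ U a) p
      ≡⟨ cong (λ z → 2ℚ * E (suc p) 0ℚ - A * B * z) (U⊛U-coeff a b p even p≢0) ⟩
    ℕ→ℚ 2 * E (suc p) (ℕ→ℚ 0)
      - A * B * Σ< p (λ k → ℕ→ℚ (p C k) * (B ^ℚ k) * E k (ℕ→ℚ 0) * (A ^ℚ (p ∸ k)) * E (p ∸ k) (ℕ→ℚ 0)) ∎
  odd-case : (p : ℕ) → p % 2 ≡ 1 →
    (B ^ℚ p) * T p a b - (A ^ℚ p) * T p b a ≡ ((A ^ℚ p) - (B ^ℚ p)) * E p (ℕ→ℚ 0)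
  odd-case p oddp = trans
    (cong₂ _-_ (T-odd a b odda oddb coprime p oddp) (T-odd b a oddb odda (Coprimality.sym coprime) p oddp))
    (solve 3 (λ x y e → :- (y :* e) :- :- (x :* e) := (x :- y) :* e) refl (A ^ℚ p) (B ^ℚ p) (E p 0ℚ))
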